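{- Let $p>3$ be a prime. Then, modulo $p$: $$P_{\frac{p-1}2}(-31)\equiv\sum_{k=0}^{\frac{p-1}2}\binom{2k}k^2\equiv\sum_{k=0}^{\frac{p-1}2}\frac{\binom{2k}k^2}{256^k}\equiv-\Big(\frac p3\Big)\sum_{x=0}^{p-1}\Big(\frac{x^3-723x-7378}p\Big),$$ $$P_{\frac{p-1}2}(33)\equiv\sum_{k=0}^{\frac{p-1}2}(-1)^k\binom{2k}k^2\equiv(-1)^{\frac{p-1}2}\sum_{k=0}^{\frac{p-1}2}\frac{\binom{2k}k^2}{(-256)^k}\equiv(-1)^{\frac{p+1}2}\sum_{x=0}^{p-1}\Big(\frac{x^3-91x+330}p\Big),$$ $$P_{\frac{p-1}2}(-15)\equiv\sum_{k=0}^{\frac{p-1}2}\frac{\binom{2k}k^2}{2^k}\equiv\Big(\frac2p\Big)\sum_{k=0}^{\frac{p-1}2}\frac{\binom{2k}k^2}{128^k}\equiv(-1)^{\frac{p+1}2}\sum_{x=0}^{p-1}\Big(\frac{x^3-19x-30}p\Big),$$ $$P_{\frac{p-1}2}(9)\equiv\sum_{k=0}^{\frac{p-1}2}\frac{\binom{2k}k^2}{(-4)^k}\equiv(-1)^{\frac{p-1}2}\sum_{k=0}^{\frac{p-1}2}\frac{\binom{2k}k^2}{(-64)^k}\equiv(-1)^{\frac{p+1}2}\sum_{x=0}^{p-1}\Big(\frac{x^3-7x+6}p\Big),$$ $$P_{\frac{p-1}2}(5)\equiv\sum_{k=0}^{\frac{p-1}2}\frac{\binom{2k}k^2}{(-8)^k}\equiv\Big(\frac{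 -2}p\Big)\sum_{k=0}^{\frac{p-1}2}\frac{\binom{2k}k^2}{(-32)^k}\equiv-\Big(\frac p3\Big)\sum_{x=0}^{p-1}\Big(\frac{x^3-21x+20}p\Big).$$
   Context: Congruences are between rational numbers whose denominators are prime to $p$. $\big(\frac ap\big)$ is the Legendre symbol (equal to $0$ if $p\mid a$). $P_n(x)$ is the $n$-th Legendre polynomial, defined by $\frac1{\sqrt{1-2xt+t^2}}=\sum_{n\ge0}P_n(x)t^n$, equivalently $P_n(x)=\frac1{2^n}\sum_{k=0}^{[n/2]}\frac{(-1)^k(2n-2k)!}{k!(n-k)!(n-2k)!}x^{n-2k}$. -}

module Defs where

import Algebra.Definitions.RawSemiring as RawSemiring
open import Data.Bool using (if_then_else_)
open import Data.Fin using (toℕ)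
open import Data.Fin.Properties using (any?)
open import Data.Integer as ℤ using (ℤ; +_; 0ℤ; 1ℤ; -1ℤ)
open import Data.Integer.Divisibility.Signed as ℤ using (_∣?_; _∣_)
open import Data.Integer.GCD using (gcd)
open import Data.Integer.Properties as ℤ using ()
open import Data.Nat as ℕ using (ℕ; zero; suc; _!; _∸_; ⌊_/2⌋)
open import Data.Nat.Combinatorics using (_C_)
open import Data.Nat.Coprimality using (Coprime)
open import Data.Nat.Properties as ℕ using (_!≢0)
open import Data.Product using (_×_)
open import Data.Rational as ℚ using (ℚ; ½; ↥_; ↧ₙ_; _/_; _÷_)
open import Data.Rational.Properties as ℚ using ()
open import Relation.Binary.PropositionalEquality using (sym; trans; cong)
open import Relation.Nullary using (does)

open RawSemiring ℚ.+-*-rawSemiring public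
  using () renaming (_^_ to _^ℚ_; sum to sumℚ)
open RawSemiring ℤ.+-*-rawSemiring public
  using () renaming (sum to sumℤ)

ι : ℤ → ℚ
ι i = i / 1

-- ∑≤ n f = f 0 + f 1 + ⋯ + f n  (the upper bound is included).
∑≤ : ℕ → (ℕ → ℚ) → ℚ
∑≤ n f = sumℚ {suc n} (λ k → f (toℕ k))

infix 5 ∑≤
syntax ∑≤ n (λ k → e) = ∑[ k ≤ n ] e

-- Being in lowest terms, a and b have well-defined denominators.
infix 4 _≡_[mod_] _≡_≡_≡_[mod_]

record _≡_[mod_] (a b : ℚ) (p : ℕ) : Set where
  constructor congruent
  field
    denominatorˡ : Coprime (↧ₙ a) p
    denominatorʳ : Coprime (↧ₙ b) p
    divides      : + p ∣ ↥ (a ℚ.- b)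

_≡_≡_≡_[mod_] : (a b c d : ℚ) (p : ℕ) → Set
a ≡ b ≡ c ≡ d [mod p ] = a ≡ b [mod p ] × b ≡ c [mod p ] × c ≡ d [mod p ]

-- The Legendre symbol (a / p), meaningful for p an odd prime.
legendre : ℤ → ℕ → ℤ
legendre a p =
  if does (+ p ∣? a) then 0ℤ
  else if does (any? {n = p} λ x → + p ∣? ((+ toℕ x) ℤ.^ 2 ℤ.- a)) then 1ℤ
  else -1ℤ

-- The sum over x = 0, …, p - 1 of the Legendre symbols (f x / p).
legendreSum : ℕ → (ℤ → ℤ) → ℤ
legendreSum p f = sumℤ {p} (λ x → legendre (f (+ toℕ x)) p)

-- The n-th Legendre polynomial at x.  Only k with 2k ≤ n occur, so no
-- truncated subtraction below is ever actually truncated.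
P : ℕ → ℚ → ℚ
P n x = (½ ^ℚ n) ℚ.* (∑[ k ≤ ⌊ n /2⌋ ] (coeff k ℚ.* x ^ℚ (n ∸ 2 ℕ.* k)))
  where
  coeff : ℕ → ℚ
  coeff k = (-1ℤ ℤ.^ k ℤ.* + ((2 ℕ.* n ∸ 2 ℕ.* k) !)) / (k ! ℕ.* (n ∸ k) ! ℕ.* (n ∸ 2 ℕ.* k) !)
    where instance
      denominator≢0 : ℕ.NonZero (k ! ℕ.* (n ∸ k) ! ℕ.* (n ∸ 2 ℕ.* k) !)
      denominator≢0 = ℕ.m*n≢0 _ _ {{ℕ.m*n≢0 _ _ {{k !≢0}} {{(n ∸ k) !≢0}}}} {{(n ∸ 2 ℕ.* k) !≢0}}

C² : ℕ → ℤ
C² k = (+ ((2 ℕ.* k) C k)) ℤ.^ 2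

ι-nonZero : ∀ m → .{{ℤ.NonZero m}} → ℚ.NonZero (ι m)
ι-nonZero m = ℚ.≢-nonZero {ι m} λ ιm≡0 → ℕ.≢-nonZero⁻¹ ℤ.∣ m ∣
  (cong ℤ.∣_∣ (trans (sym (ℚ.↥-/ m 1)) (cong (λ q → ↥ q ℤ.* gcd m (+ 1)) ιm≡0)))

^-nonZero : ∀ m k → .{{ℤ.NonZero m}} → ℤ.NonZero (m ℤ.^ k)
^-nonZero m zero    = _
^-nonZero m (suc k) = ℤ.i*j≢0 m (m ℤ.^ k)
  where instance
    m^k≢0 : ℤ.NonZero (m ℤ.^ k)
    m^k≢0 = ^-nonZero m k

-- a /[ m ^ k ] is the rational number a / mᵏ.
infix 8 _/[_^_]
_/[_^_] : (a m : ℤ) (k : ℕ) → .{{ℤ.NonZero m}} → ℚ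
a /[ m ^ k ] = (ι a ÷ ι (m ℤ.^ k)) {{ι-nonZero (m ℤ.^ k) {{^-nonZero m k}}}}

{-# OPTIONS --safe #-}

-- Write p = 2n + 1 and K(t) = ∑ₖ C(n,k)² tᵏ.  Modulo p every quantity in the row of a given t is
-- congruent to K(t), where t = 16, -16, 8, -4, -2.
--
-- Since C(2k,k) ≡ (-4)ᵏ C(n,k), the first binomial sum is K(t), and the second one is tⁿ K(t) by the
-- symmetry k ↦ n - k; the sign in front of it is ≡ tⁿ, whose square is 1.
--
-- The two remaining quantities come from the power sums: ∑ₓ xʲ over the residues x is -1 for j = 2n
-- and 0 for every other j < 4n, so a complete sum of polynomial values extracts a coefficient.
-- Applied to (x(x + a)(x + at))ⁿ this gives -aⁿ K(t), which by Euler's criterion is the sum of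
-- Legendre symbols of the cubic.  Applied to (y((y + x)² - 1))ⁿ with x = 1 - 2t it gives, by
-- expanding, -2ⁿ Pₙ(x), and, since y((y + x)² - 1) becomes v(v + 2)(v + 2t) for y = v + 2t, also
-- -2ⁿ K(t).
--
-- Euler's criterion is another coefficient extraction: for a non-residue a, ∑ₓ (x² - a)²ⁿ ≡ p ≡ 0,
-- while the expansion gives -(aⁿ + 1).
module Submission where

open import Defs
import Algebra.Properties.Semiring.Sum as SemiringSum
open import Data.Bool using (if_then_else_)
open import Data.Fin as Fin using (Fin; toℕ; fromℕ<)
import Data.Fin.Properties as Fin
open import Data.Integer as ℤ using (ℤ; +_; -[1+_]; -_; _+_; _-_; _*_; _^_; 0ℤ; 1ℤ; -1ℤ)
open import Data.Integer.Divisibility.Signed as ℤ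
  using (_∣_; _∣?_; divides; ∣⇒∣ᵤ; ∣ᵤ⇒∣; ∣m∣n⇒∣m+n; ∣m+n∣m⇒∣n; ∣m⇒∣-m; ∣n⇒∣m*n; ∣m⇒∣m*n)
import Data.Integer.Properties as ℤ
open import Data.Integer.Tactic.RingSolver using (solve-∀)
open import Data.Nat as ℕ using (ℕ; zero; suc; _∸_; _/_; _%_; _!; ⌊_/2⌋; ⌈_/2⌉; z≤n; s≤s)
open import Data.Nat.Combinatorics
  using (_C_; nCk+nC[k+1]≡[n+1]C[k+1]; k>n⇒nCk≡0; nCn≡1; nC1≡n; nCk≡nC[n∸k]; nCk≡n!/k![n-k]!; k![n∸k]!∣n!)
open import Data.Nat.Coprimality as Coprimality using (Coprime)
open import Data.Nat.DivMod using (m%n<n; m≡m%n+[m/n]*n; m*n/n≡m; m/n*n≡m)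
import Data.Nat.Divisibility as ℕ
open import Data.Nat.Induction using (<-rec)
open import Data.Nat.Primality using (Prime; prime⇒irreducible; euclidsLemma)
import Data.Nat.Properties as ℕ
open import Data.Product using (_×_; _,_; ∃; proj₁; proj₂)
open import Data.Rational as ℚ using (ℚ; mkℚ; ½; ↥_; ↧_; ↧ₙ_)
import Data.Rational.Properties as ℚ
open import Data.Rational.Solver using (module +-*-Solver)
open import Data.Rational.Unnormalised as ℚᵘ using (mkℚᵘ; *≡*)
import Data.Rational.Unnormalised.Properties as ℚᵘ
open import Data.Sum as Sum using (_⊎_; inj₁; inj₂)
open import Function using (_∘_)
open import Relation.Binary.Bundles using (Setoid)
open import Relation.Binary.Definitions using (tri<; tri≈; tri>)
open import Relation.Binary.PropositionalEquality
  using (_≡_; _≢_; refl; sym; trans; cong; cong₂; subst; module ≡-Reasoning)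
import Relation.Binary.Reasoning.Setoid as SetoidReasoning
open import Relation.Nullary using (¬_; Dec; does; yes; no; contradiction)
open import Relation.Nullary.Decidable using (from-no)

-- Everything meets because n ≡ -1/2 modulo p: then C(n,k) ≡ C(-1/2,k), which is C(2k,k)/(-4)ᵏ, and
-- K(t) is the Hasse invariant of the curve y² = x(x + 1)(x + t). The rows differ only in t and in
-- a, a difference of two roots of the cubic. Since a is -1 or -3, the character sums carry the sign
-- -(-1)ⁿ or -(-3)ⁿ ≡ -(p/3). The obstacle is Pₙ, which is defined by powers of x, whereas K has
-- powers of t = (1 - x)/2. Instead of re-expanding, one uses Rodrigues' formula: 2ⁿ Pₙ(x) is the
-- coefficient of yⁿ in ((y + x)² - 1)ⁿ, hence that of y²ⁿ once the factor yⁿ is added. Over ℤ this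
-- coefficient changes when y is translated; modulo p the complete sum that extracts it does not, so
-- the passage from x to t is a mere translation. The products of three linear factors have degree
-- 3n < 4n, so that only y²ⁿ survives summation. No step asks for distinct roots modulo p, so a row
-- such as t = 16 at p = 5, where t ≡ 1, needs no separate treatment.

-- Finite sums and binomial coefficients over the integers

module IntegerSums where

  module ∑ = SemiringSum ℤ.+-*-semiring

  open ≡-Reasoning

  opaque
    ∑< : ℕ → (ℕ → ℤ) → ℤ
    ∑< n f = sumℤ {n} (λ k → f (toℕ k))

  infix 5 ∑<
  syntax ∑< n (λ k → e) = ∑[ k < n ] e

  opaque
    unfolding ∑<

    ∑-sumℤ : ∀ n (f : ℕ → ℤ) → sumℤ {n} (λ k → f (toℕ k)) ≡ ∑< n f
    ∑-sumℤ n f = refl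

    ∑-empty : ∀ (f : ℕ → ℤ) → ∑< 0 f ≡ 0ℤ
    ∑-empty f = refl

    ∑-first : ∀ n (f : ℕ → ℤ) → ∑< (suc n) f ≡ f 0 + ∑< n (f ∘ suc)
    ∑-first n f = refl

    ∑-cong : ∀ n {f g : ℕ → ℤ} → (∀ k → k ℕ.< n → f k ≡ g k) → ∑< n f ≡ ∑< n g
    ∑-cong zero    f≡g = refl
    ∑-cong (suc n) f≡g = cong₂ _+_ (f≡g 0 (s≤s z≤n)) (∑-cong n λ k k<n → f≡g (suc k) (s≤s k<n))

    ∑-+ : ∀ n (f g : ℕ → ℤ) → (∑[ k < n ] f k + g k) ≡ ∑< n f + ∑< n g
    ∑-+ n f g = ∑.∑-distrib-+ {n} (f ∘ toℕ) (g ∘ toℕ)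

    ∑-*ˡ : ∀ n c (f : ℕ → ℤ) → c * ∑< n f ≡ ∑[ k < n ] c * f k
    ∑-*ˡ n c f = ∑.*-distribˡ-sum {n} c (f ∘ toℕ)

    ∑-swap : ∀ m n (f : ℕ → ℕ → ℤ) → (∑[ i < m ] ∑[ j < n ] f i j) ≡ ∑[ j < n ] ∑[ i < m ] f i j
    ∑-swap m n f = ∑.∑-comm {m} {n} λ i j → f (toℕ i) (toℕ j)

  ∑-last : ∀ n (f : ℕ → ℤ) → ∑< (suc n) f ≡ ∑< n f + f n
  ∑-last zero    f = begin
    ∑< 1 f                             ≡⟨ ∑-first 0 f ⟩
    f 0 + ∑< 0 (f ∘ suc)               ≡⟨ cong (_+_ (f 0)) (trans (∑-empty _) (sym (∑-empty f))) ⟩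
    f 0 + ∑< 0 f                       ≡⟨ ℤ.+-comm (f 0) _ ⟩
    ∑< 0 f + f 0                       ∎
  ∑-last (suc n) f = begin
    ∑< (suc (suc n)) f                 ≡⟨ ∑-first (suc n) f ⟩
    f 0 + ∑< (suc n) (f ∘ suc)         ≡⟨ cong (_+_ (f 0)) (∑-last n (f ∘ suc)) ⟩
    f 0 + (∑< n (f ∘ suc) + f (suc n)) ≡⟨ ℤ.+-assoc (f 0) _ _ ⟨
    f 0 + ∑< n (f ∘ suc) + f (suc n)   ≡⟨ cong (_+ f (suc n)) (∑-first n f) ⟨
    ∑< (suc n) f + f (suc n)           ∎

  ∑-reverse : ∀ n (f : ℕ → ℤ) → ∑< (suc n) f ≡ ∑[ k < suc n ] f (n ∸ k)
  ∑-reverse zero    f = ∑-cong 1 λ { zero _ → refl ; (suc _) (s≤s ()) }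
  ∑-reverse (suc n) f = begin
    ∑< (suc (suc n)) f                          ≡⟨ ∑-last (suc n) f ⟩
    ∑< (suc n) f + f (suc n)                    ≡⟨ cong (_+ f (suc n)) (∑-reverse n f) ⟩
    (∑[ k < suc n ] f (n ∸ k)) + f (suc n)      ≡⟨ ℤ.+-comm _ (f (suc n)) ⟩
    f (suc n) + (∑[ k < suc n ] f (n ∸ k))      ≡⟨ ∑-first (suc n) (λ k → f (suc n ∸ k)) ⟨
    (∑[ k < suc (suc n) ] f (suc n ∸ k))        ∎

  ∑-telescope : ∀ n (f : ℕ → ℤ) → (∑[ k < n ] f (suc k) - f k) ≡ f n - f 0
  ∑-telescope zero    f = trans (∑-empty _) (sym (ℤ.+-inverseʳ (f 0)))
  ∑-telescope (suc n) f = begin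
    (∑[ k < suc n ] f (suc k) - f k)               ≡⟨ ∑-last n (λ k → f (suc k) - f k) ⟩
    (∑[ k < n ] f (suc k) - f k) + (f (suc n) - f n) ≡⟨ cong (_+ (f (suc n) - f n)) (∑-telescope n f) ⟩
    f n - f 0 + (f (suc n) - f n)                  ≡⟨ rearrange (f n) (f 0) (f (suc n)) ⟩
    f (suc n) - f 0                                ∎
    where
    rearrange : ∀ a b c → a - b + (c - a) ≡ c - b
    rearrange = solve-∀

  0^k≡0 : ∀ k → 0 ℕ.< k → 0ℤ ^ k ≡ 0ℤ
  0^k≡0 (suc k) _ = ℤ.*-zeroˡ (0ℤ ^ k)

  ^-distribʳ-* : ∀ a b k → (a * b) ^ k ≡ a ^ k * b ^ k
  ^-distribʳ-* a b zero    = refl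
  ^-distribʳ-* a b (suc k) = trans (cong (a * b *_) (^-distribʳ-* a b k)) (interchange a b (a ^ k) (b ^ k))
    where
    interchange : ∀ a b c d → a * b * (c * d) ≡ a * c * (b * d)
    interchange = solve-∀

  opaque
    binom : ℕ → ℕ → ℤ
    binom n k = + (n C k)

    binom-C : ∀ n k → + (n C k) ≡ binom n k
    binom-C n k = refl

    binom-pascal : ∀ n k → binom (suc n) (suc k) ≡ binom n k + binom n (suc k)
    binom-pascal n k = cong +_ (sym (nCk+nC[k+1]≡[n+1]C[k+1] n k))

    binom-zero : ∀ {n k} → n ℕ.< k → binom n k ≡ 0ℤ
    binom-zero n<k = cong +_ (k>n⇒nCk≡0 n<k)

    binom-n-0 : ∀ n → binom n 0 ≡ 1ℤ
    binom-n-0 zero    = refl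
    binom-n-0 (suc n) = refl

    binom-n-n : ∀ n → binom n n ≡ 1ℤ
    binom-n-n n = cong +_ (nCn≡1 n)

    binom-n-1 : ∀ n → binom n 1 ≡ + n
    binom-n-1 n = cong +_ (nC1≡n n)

    binom-sym : ∀ {n k} → k ℕ.≤ n → binom n (n ∸ k) ≡ binom n k
    binom-sym k≤n = cong +_ (sym (nCk≡nC[n∸k] k≤n))

  -- An arbitrary weight in place of xⁱyʲ lets one recursion serve both the binomial theorem and the
  -- powers of 1 + √-3, whose terms are not powers of an integer.
  binomialSum : ℕ → (ℕ → ℕ → ℤ) → ℤ
  binomialSum m w = ∑[ k < suc m ] binom m k * w k (m ∸ k)

  -- Pascal's rule, read as formal multiplication by x + y: x raises the first exponent and y the
  -- second.
  binomialSum-suc : ∀ m w → binomialSum (suc m) w ≡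
    binomialSum m (λ i j → w (suc i) j) + binomialSum m (λ i j → w i (suc j))
  binomialSum-suc m w = begin
    binomialSum (suc m) w
      ≡⟨ ∑-first (suc m) _ ⟩
    head + (∑[ k < suc m ] binom (suc m) (suc k) * w (suc k) (m ∸ k))
      ≡⟨ cong (_+_ head) (∑-cong (suc m) λ k _ → trans (cong (_* w (suc k) (m ∸ k)) (binom-pascal m k))
           (ℤ.*-distribʳ-+ (w (suc k) (m ∸ k)) (binom m k) (binom m (suc k)))) ⟩
    head + (∑[ k < suc m ] binom m k * w (suc k) (m ∸ k) + binom m (suc k) * w (suc k) (m ∸ k))
      ≡⟨ cong (_+_ head) (∑-+ (suc m) (λ k → binom m k * w (suc k) (m ∸ k)) _) ⟩
    head + (left + (∑[ k < suc m ] binom m (suc k) * w (suc k) (m ∸ k)))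
      ≡⟨ swap head left _ ⟩
    left + (head + (∑[ k < suc m ] binom m (suc k) * w (suc k) (m ∸ k)))
      ≡⟨ cong (λ h → left + (h * w 0 (suc m) + (∑[ k < suc m ] binom m (suc k) * w (suc k) (m ∸ k))))
           (trans (binom-n-0 (suc m)) (sym (binom-n-0 m))) ⟩
    left + (binom m 0 * w 0 (suc m) + (∑[ k < suc m ] binom m (suc k) * w (suc k) (m ∸ k)))
      ≡⟨ cong (_+_ left) (∑-first (suc m) (λ k → binom m k * w k (suc m ∸ k))) ⟨
    left + (∑[ k < suc (suc m) ] binom m k * w k (suc m ∸ k))
      ≡⟨ cong (_+_ left) (∑-last (suc m) (λ k → binom m k * w k (suc m ∸ k))) ⟩
    left + ((∑[ k < suc m ] binom m k * w k (suc m ∸ k)) + binom m (suc m) * w (suc m) (m ∸ m))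
      ≡⟨ cong (λ h → left + ((∑[ k < suc m ] binom m k * w k (suc m ∸ k)) + h * w (suc m) (m ∸ m))) (binom-zero (ℕ.n<1+n m)) ⟩
    left + ((∑[ k < suc m ] binom m k * w k (suc m ∸ k)) + 0ℤ)
      ≡⟨ cong (_+_ left) (ℤ.+-identityʳ _) ⟩
    left + (∑[ k < suc m ] binom m k * w k (suc m ∸ k))
      ≡⟨ cong (_+_ left) (∑-cong (suc m) λ { k (s≤s k≤m) → cong (λ j → binom m k * w k j) (ℕ.+-∸-assoc 1 k≤m) }) ⟩
    -- The exponents agree only for k ≤ m, where `suc m ∸ k` is `suc (m ∸ k)`; the term k = m + 1
    -- was therefore removed before, by C(m,m + 1) = 0.
    left + binomialSum m (λ i j → w i (suc j)) ∎
    where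
    head = binom (suc m) 0 * w 0 (suc m)
    left = binomialSum m (λ i j → w (suc i) j)
    swap : ∀ a b c → a + (b + c) ≡ b + (a + c)
    swap = solve-∀

  binomialSum-cong : ∀ m {v w : ℕ → ℕ → ℤ} → (∀ i j → v i j ≡ w i j) → binomialSum m v ≡ binomialSum m w
  binomialSum-cong m v≡w = ∑-cong (suc m) λ k _ → cong (binom m k *_) (v≡w k (m ∸ k))

  binomialSum-*ˡ : ∀ m c (w : ℕ → ℕ → ℤ) → c * binomialSum m w ≡ binomialSum m (λ i j → c * w i j)
  binomialSum-*ˡ m c w = trans (∑-*ˡ (suc m) c _)
    (∑-cong (suc m) λ k _ → swap c (binom m k) (w k (m ∸ k)))
    where
    swap : ∀ a b c → a * (b * c) ≡ b * (a * c)
    swap = solve-∀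

  binomial-theorem : ∀ m x y → (x + y) ^ m ≡ binomialSum m (λ i j → x ^ i * y ^ j)
  binomial-theorem zero    x y = sym (trans (∑-first 0 _)
    (cong₂ _+_ (cong (_* 1ℤ) (binom-n-0 0)) (∑-empty _)))
  binomial-theorem (suc m) x y = begin
    (x + y) * (x + y) ^ m
      ≡⟨ cong ((x + y) *_) (binomial-theorem m x y) ⟩
    (x + y) * binomialSum m (λ i j → x ^ i * y ^ j)
      ≡⟨ ℤ.*-distribʳ-+ (binomialSum m (λ i j → x ^ i * y ^ j)) x y ⟩
    x * binomialSum m (λ i j → x ^ i * y ^ j) + y * binomialSum m (λ i j → x ^ i * y ^ j)
      ≡⟨ cong₂ _+_ (binomialSum-*ˡ m x λ i j → x ^ i * y ^ j) (binomialSum-*ˡ m y λ i j → x ^ i * y ^ j) ⟩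
    binomialSum m (λ i j → x * (x ^ i * y ^ j)) + binomialSum m (λ i j → y * (x ^ i * y ^ j))
      ≡⟨ cong₂ _+_ (binomialSum-cong m λ i j → sym (ℤ.*-assoc x (x ^ i) (y ^ j)))
                   (binomialSum-cong m λ i j → swap y (x ^ i) (y ^ j)) ⟩
    binomialSum m (λ i j → x ^ suc i * y ^ j) + binomialSum m (λ i j → x ^ i * y ^ suc j)
      ≡⟨ binomialSum-suc m (λ i j → x ^ i * y ^ j) ⟨
    binomialSum (suc m) (λ i j → x ^ i * y ^ j) ∎
    where
    swap : ∀ a b c → a * (b * c) ≡ b * (a * c)
    swap = solve-∀

  binom-absorption : ∀ n k → + suc k * binom (suc n) (suc k) ≡ + suc n * binom n k
  binom-absorption n zero = trans (ℤ.*-identityˡ _) (trans (binom-n-1 (suc n))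
    (sym (trans (cong (+ suc n *_) (binom-n-0 n)) (ℤ.*-identityʳ (+ suc n)))))
  binom-absorption zero (suc k) = trans (cong (+ suc (suc k) *_) (binom-zero (s≤s (s≤s z≤n))))
    (trans (ℤ.*-zeroʳ (+ suc (suc k))) (sym (trans (ℤ.*-identityˡ _) (binom-zero (s≤s z≤n)))))
  binom-absorption (suc n) (suc k) = begin
    + suc (suc k) * binom (suc (suc n)) (suc (suc k))
      ≡⟨ cong (+ suc (suc k) *_) (binom-pascal (suc n) (suc k)) ⟩
    + suc (suc k) * (binom (suc n) (suc k) + binom (suc n) (suc (suc k)))
      ≡⟨ split (+ suc k) (binom (suc n) (suc k)) (binom (suc n) (suc (suc k))) ⟩
    binom (suc n) (suc k) + (+ suc k * binom (suc n) (suc k) + + suc (suc k) * binom (suc n) (suc (suc k)))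
      ≡⟨ cong (_+_ (binom (suc n) (suc k))) (cong₂ _+_ (binom-absorption n k) (binom-absorption n (suc k))) ⟩
    binom (suc n) (suc k) + (+ suc n * binom n k + + suc n * binom n (suc k))
      ≡⟨ cong (_+ (+ suc n * binom n k + + suc n * binom n (suc k))) (binom-pascal n k) ⟩
    binom n k + binom n (suc k) + (+ suc n * binom n k + + suc n * binom n (suc k))
      ≡⟨ merge (+ suc n) (binom n k) (binom n (suc k)) ⟩
    + suc (suc n) * (binom n k + binom n (suc k))
      ≡⟨ cong (+ suc (suc n) *_) (binom-pascal n k) ⟨
    + suc (suc n) * binom (suc n) (suc k) ∎
    where
    split : ∀ k a b → (1ℤ + k) * (a + b) ≡ a + (k * a + (1ℤ + k) * b)
    split = solve-∀
    merge : ∀ n a b → a + b + (n * a + n * b) ≡ (1ℤ + n) * (a + b)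
    merge = solve-∀

  -- Summed over x the left side telescopes, which turns this expansion into a recursion for power
  -- sums.
  difference-power : ∀ x j → (x + 1ℤ) ^ suc j - x ^ suc j ≡ ∑[ k < suc j ] binom (suc j) k * x ^ k
  difference-power x j = begin
    (x + 1ℤ) ^ suc j - x ^ suc j
      ≡⟨ cong (_- x ^ suc j) (binomial-theorem (suc j) x 1ℤ) ⟩
    binomialSum (suc j) (λ i l → x ^ i * 1ℤ ^ l) - x ^ suc j
      ≡⟨ cong (_- x ^ suc j) (∑-cong (suc (suc j)) λ k _ → cong (binom (suc j) k *_)
            (trans (cong (x ^ k *_) (ℤ.^-zeroˡ (suc j ∸ k))) (ℤ.*-identityʳ (x ^ k)))) ⟩
    (∑[ k < suc (suc j) ] binom (suc j) k * x ^ k) - x ^ suc j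
      ≡⟨ cong (_- x ^ suc j) (∑-last (suc j) (λ k → binom (suc j) k * x ^ k)) ⟩
    (∑[ k < suc j ] binom (suc j) k * x ^ k) + binom (suc j) (suc j) * x ^ suc j - x ^ suc j
      ≡⟨ cong (λ c → (∑[ k < suc j ] binom (suc j) k * x ^ k) + c * x ^ suc j - x ^ suc j) (binom-n-n (suc j)) ⟩
    (∑[ k < suc j ] binom (suc j) k * x ^ k) + 1ℤ * x ^ suc j - x ^ suc j
      ≡⟨ lemma _ (x ^ suc j) ⟩
    (∑[ k < suc j ] binom (suc j) k * x ^ k) ∎
    where
    lemma : ∀ a b → a + 1ℤ * b - b ≡ a
    lemma = solve-∀

  ∑-const : ∀ m c → (∑[ _ < m ] c) ≡ + m * c
  ∑-const zero    c = ∑-empty _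
  ∑-const (suc m) c = trans (∑-first m (λ _ → c)) (trans (cong (_+_ c) (∑-const m c)) (lemma c (+ m)))
    where
    lemma : ∀ c m → c + m * c ≡ (1ℤ + m) * c
    lemma = solve-∀

  ∑-neg : ∀ m (f : ℕ → ℤ) → (∑[ k < m ] - f k) ≡ - ∑< m f
  ∑-neg m f = trans (∑-cong m λ k _ → sym (ℤ.-1*i≡-i (f k))) (trans (sym (∑-*ˡ m -1ℤ f)) (ℤ.-1*i≡-i (∑< m f)))

  binom-factorial : ∀ {m k} → k ℕ.≤ m → binom m k * + (k ! ℕ.* (m ∸ k) !) ≡ + (m !)
  binom-factorial {m} {k} k≤m = trans (cong (_* + (k ! ℕ.* (m ∸ k) !)) (sym (binom-C m k)))
    (trans (sym (ℤ.pos-* (m C k) (k ! ℕ.* (m ∸ k) !)))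
    (cong +_ (trans (cong (ℕ._* (k ! ℕ.* (m ∸ k) !)) (nCk≡n!/k![n-k]! k≤m)) (m/n*n≡m (k![n∸k]!∣n! k≤m)))))
    where instance _ = ℕ._!*_!≢0 k (m ∸ k)

  ∑-truncate : ∀ m d (f : ℕ → ℤ) → (∀ k → m ℕ.≤ k → f k ≡ 0ℤ) → ∑< (m ℕ.+ d) f ≡ ∑< m f
  ∑-truncate m zero    f f≡0 = cong (λ l → ∑< l f) (ℕ.+-identityʳ m)
  ∑-truncate m (suc d) f f≡0 = trans (cong (λ l → ∑< l f) (ℕ.+-suc m d))
    (trans (∑-last (m ℕ.+ d) f)
    (trans (cong (_+_ (∑< (m ℕ.+ d) f)) (f≡0 (m ℕ.+ d) (ℕ.m≤m+n m d)))
    (trans (ℤ.+-identityʳ _) (∑-truncate m d f f≡0))))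

  -- Absorption is applied twice, from 2k + 2 down to 2k, with the symmetry C(2k + 1,k) = C(2k + 1,k
  -- + 1) in between.
  central-binom-step : ∀ k → + suc k * binom (2 ℕ.* suc k) (suc k) ≡ + 2 * ((+ k + + suc k) * binom (2 ℕ.* k) k)
  central-binom-step k = begin
    + suc k * binom (2 ℕ.* suc k) (suc k)
      ≡⟨ cong (λ j → + suc k * binom j (suc k)) (ℕ.*-suc 2 k) ⟩
    + suc k * binom (suc N) (suc k)
      ≡⟨ binom-absorption N k ⟩
    + suc N * binom N k
      ≡⟨ cong₂ _*_ (trans (cong (λ i → + suc (suc i)) 2*k≡k+k) (double (+ k))) middle ⟩
    + 2 * + suc k * binom N (suc k)
      ≡⟨ ℤ.*-assoc (+ 2) (+ suc k) (binom N (suc k)) ⟩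
    + 2 * (+ suc k * binom N (suc k))
      ≡⟨ cong (+ 2 *_) (binom-absorption (2 ℕ.* k) k) ⟩
    + 2 * (+ N * binom (2 ℕ.* k) k)
      ≡⟨ cong (λ c → + 2 * (c * binom (2 ℕ.* k) k)) (trans (cong (λ i → + suc i) 2*k≡k+k) (odd (+ k))) ⟩
    + 2 * ((+ k + + suc k) * binom (2 ℕ.* k) k) ∎
    where
    N = suc (2 ℕ.* k)
    2*k≡k+k : 2 ℕ.* k ≡ k ℕ.+ k
    2*k≡k+k = cong (k ℕ.+_) (ℕ.+-identityʳ k)
    middle : binom N k ≡ binom N (suc k)
    middle = trans (cong (binom N) (sym (trans (cong (_∸ k) 2*k≡k+k) (ℕ.m+n∸n≡m k k))))
      (binom-sym (s≤s (ℕ.m≤m+n k _)))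
    double : ∀ k → 1ℤ + (1ℤ + (k + k)) ≡ + 2 * (1ℤ + k)
    double = solve-∀
    odd : ∀ k → 1ℤ + (k + k) ≡ k + (1ℤ + k)
    odd = solve-∀

  binom-ratio : ∀ m k → + suc k * binom m (suc k) ≡ (+ m - + k) * binom m k
  binom-ratio m k = trans (lemma₁ (+ suc k) (binom m k) (binom m (suc k)))
    (trans (cong (_- + suc k * binom m k) (trans (cong (+ suc k *_) (sym (binom-pascal m k))) (binom-absorption m k)))
      (lemma₂ (+ m) (+ k) (binom m k)))
    where
    lemma₁ : ∀ k a b → k * b ≡ k * (a + b) - k * a
    lemma₁ = solve-∀
    lemma₂ : ∀ m k a → (1ℤ + m) * a - (1ℤ + k) * a ≡ (m - k) * a
    lemma₂ = solve-∀

-- Rational numbers as integer fractions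

module Fractions where

  toℚᵘ-ι : ∀ a → ℚ.toℚᵘ (ι a) ℚᵘ.≃ mkℚᵘ a 0
  toℚᵘ-ι a = ℚ.toℚᵘ-fromℚᵘ (mkℚᵘ a 0)

  ι-+ : ∀ a b → ι (a ℤ.+ b) ≡ ι a ℚ.+ ι b
  ι-+ a b = ℚ.toℚᵘ-injective (begin
    ℚ.toℚᵘ (ι (a ℤ.+ b))               ≈⟨ toℚᵘ-ι (a ℤ.+ b) ⟩
    mkℚᵘ (a ℤ.+ b) 0                   ≈⟨ *≡* (lemma a b) ⟩
    mkℚᵘ a 0 ℚᵘ.+ mkℚᵘ b 0             ≈⟨ ℚᵘ.+-cong (toℚᵘ-ι a) (toℚᵘ-ι b) ⟨
    ℚ.toℚᵘ (ι a) ℚᵘ.+ ℚ.toℚᵘ (ι b)     ≈⟨ ℚ.toℚᵘ-homo-+ (ι a) (ι b) ⟨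
    ℚ.toℚᵘ (ι a ℚ.+ ι b)               ∎)
    where
    open import Relation.Binary.Reasoning.Setoid ℚᵘ.≃-setoid
    lemma : ∀ a b → (a ℤ.+ b) ℤ.* 1ℤ ≡ (a ℤ.* 1ℤ ℤ.+ b ℤ.* 1ℤ) ℤ.* 1ℤ
    lemma = solve-∀

  ι-* : ∀ a b → ι (a ℤ.* b) ≡ ι a ℚ.* ι b
  ι-* a b = ℚ.toℚᵘ-injective (begin
    ℚ.toℚᵘ (ι (a ℤ.* b))               ≈⟨ toℚᵘ-ι (a ℤ.* b) ⟩
    mkℚᵘ a 0 ℚᵘ.* mkℚᵘ b 0             ≈⟨ ℚᵘ.*-cong (toℚᵘ-ι a) (toℚᵘ-ι b) ⟨
    ℚ.toℚᵘ (ι a) ℚᵘ.* ℚ.toℚᵘ (ι b)     ≈⟨ ℚ.toℚᵘ-homo-* (ι a) (ι b) ⟨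
    ℚ.toℚᵘ (ι a ℚ.* ι b)               ∎)
    where open import Relation.Binary.Reasoning.Setoid ℚᵘ.≃-setoid

  ι-neg : ∀ a → ι (ℤ.- a) ≡ ℚ.- ι a
  ι-neg a = ℚ.toℚᵘ-injective (begin
    ℚ.toℚᵘ (ι (ℤ.- a))                 ≈⟨ toℚᵘ-ι (ℤ.- a) ⟩
    ℚᵘ.- mkℚᵘ a 0                      ≈⟨ ℚᵘ.-‿cong (toℚᵘ-ι a) ⟨
    ℚᵘ.- ℚ.toℚᵘ (ι a)                  ≈⟨ ℚ.toℚᵘ-homo‿- (ι a) ⟨
    ℚ.toℚᵘ (ℚ.- ι a)                   ∎)
    where open import Relation.Binary.Reasoning.Setoid ℚᵘ.≃-setoid

  -- Transfers any representation m/d of `q` to its lowest terms, in which the congruences of the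
  -- theorem are phrased.
  cross-multiply : ∀ q d m → q ℚ.* ι d ≡ ι m → ↥ q ℤ.* d ≡ m ℤ.* ↧ q
  cross-multiply q@(mkℚ _ _ _) d m eq = unwrap (begin
    ℚ.toℚᵘ q ℚᵘ.* mkℚᵘ d 0             ≈⟨ ℚᵘ.*-congˡ {ℚ.toℚᵘ q} (toℚᵘ-ι d) ⟨
    ℚ.toℚᵘ q ℚᵘ.* ℚ.toℚᵘ (ι d)         ≈⟨ ℚ.toℚᵘ-homo-* q (ι d) ⟨
    ℚ.toℚᵘ (q ℚ.* ι d)                 ≡⟨ cong ℚ.toℚᵘ eq ⟩
    ℚ.toℚᵘ (ι m)                       ≈⟨ toℚᵘ-ι m ⟩
    mkℚᵘ m 0                           ∎)
    where
    open import Relation.Binary.Reasoning.Setoid ℚᵘ.≃-setoid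
    unwrap : ℚ.toℚᵘ q ℚᵘ.* mkℚᵘ d 0 ℚᵘ.≃ mkℚᵘ m 0 → ↥ q ℤ.* d ≡ m ℤ.* ↧ q
    unwrap (*≡* e) = trans (sym (ℤ.*-identityʳ _)) (trans e (cong (λ k → m ℤ.* + k) (ℕ*-identityʳ _)))
      where open import Data.Nat.Properties using () renaming (*-identityʳ to ℕ*-identityʳ)

  /-cancel : ∀ a d .{{_ : ℕ.NonZero d}} → (a ℚ./ d) ℚ.* ι (+ d) ≡ ι a
  /-cancel a d@(suc d-1) = ℚ.toℚᵘ-injective (begin
    ℚ.toℚᵘ ((a ℚ./ d) ℚ.* ι (+ d))             ≈⟨ ℚ.toℚᵘ-homo-* (a ℚ./ d) (ι (+ d)) ⟩
    ℚ.toℚᵘ (a ℚ./ d) ℚᵘ.* ℚ.toℚᵘ (ι (+ d))     ≈⟨ ℚᵘ.*-cong (ℚ.toℚᵘ-fromℚᵘ (mkℚᵘ a d-1)) (toℚᵘ-ι (+ d)) ⟩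
    mkℚᵘ a d-1 ℚᵘ.* mkℚᵘ (+ d) 0               ≈⟨ *≡* (lemma a (+ d)) ⟩
    mkℚᵘ a 0                                   ≈⟨ toℚᵘ-ι a ⟨
    ℚ.toℚᵘ (ι a)                               ∎)
    where
    open import Relation.Binary.Reasoning.Setoid ℚᵘ.≃-setoid
    lemma : ∀ a d → a ℤ.* d ℤ.* 1ℤ ≡ a ℤ.* (d ℤ.* 1ℤ)
    lemma = solve-∀

  ÷-cancel : ∀ a b .{{_ : ℚ.NonZero b}} → (a ℚ.÷ b) ℚ.* b ≡ a
  ÷-cancel a b = trans (ℚ.*-assoc a (ℚ.1/ b) b) (trans (cong (a ℚ.*_) (ℚ.*-inverseˡ b)) (ℚ.*-identityʳ a))

  fraction-* : ∀ q r d e m k → q ℚ.* ι d ≡ ι m → r ℚ.* ι e ≡ ι k → (q ℚ.* r) ℚ.* ι (d ℤ.* e) ≡ ι (m ℤ.* k)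
  fraction-* q r d e m k qd≡m re≡k = begin
    q ℚ.* r ℚ.* ι (d ℤ.* e)           ≡⟨ cong (q ℚ.* r ℚ.*_) (ι-* d e) ⟩
    q ℚ.* r ℚ.* (ι d ℚ.* ι e)         ≡⟨ interchange q r (ι d) (ι e) ⟩
    q ℚ.* ι d ℚ.* (r ℚ.* ι e)         ≡⟨ cong₂ ℚ._*_ qd≡m re≡k ⟩
    ι m ℚ.* ι k                       ≡⟨ ι-* m k ⟨
    ι (m ℤ.* k)                       ∎
    where
    open ≡-Reasoning
    open +-*-Solver
    interchange : ∀ a b c d → a ℚ.* b ℚ.* (c ℚ.* d) ≡ a ℚ.* c ℚ.* (b ℚ.* d)
    interchange = solve 4 (λ a b c d → a :* b :* (c :* d) := a :* c :* (b :* d)) refl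

  fraction-+ : ∀ q r d e m k → q ℚ.* ι d ≡ ι m → r ℚ.* ι e ≡ ι k →
               (q ℚ.+ r) ℚ.* ι (d ℤ.* e) ≡ ι (m ℤ.* e ℤ.+ k ℤ.* d)
  fraction-+ q r d e m k qd≡m re≡k = begin
    (q ℚ.+ r) ℚ.* ι (d ℤ.* e)                         ≡⟨ cong ((q ℚ.+ r) ℚ.*_) (ι-* d e) ⟩
    (q ℚ.+ r) ℚ.* (ι d ℚ.* ι e)                       ≡⟨ distribute q r (ι d) (ι e) ⟩
    q ℚ.* ι d ℚ.* ι e ℚ.+ r ℚ.* ι e ℚ.* ι d           ≡⟨ cong₂ (λ u v → u ℚ.* ι e ℚ.+ v ℚ.* ι d) qd≡m re≡k ⟩
    ι m ℚ.* ι e ℚ.+ ι k ℚ.* ι d                       ≡⟨ cong₂ ℚ._+_ (ι-* m e) (ι-* k d) ⟨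
    ι (m ℤ.* e) ℚ.+ ι (k ℤ.* d)                       ≡⟨ ι-+ (m ℤ.* e) (k ℤ.* d) ⟨
    ι (m ℤ.* e ℤ.+ k ℤ.* d)                           ∎
    where
    open ≡-Reasoning
    open +-*-Solver
    distribute : ∀ a b c d → (a ℚ.+ b) ℚ.* (c ℚ.* d) ≡ a ℚ.* c ℚ.* d ℚ.+ b ℚ.* d ℚ.* c
    distribute = solve 4 (λ a b c d → (a :+ b) :* (c :* d) := a :* c :* d :+ b :* d :* c) refl

open IntegerSums
open Fractions

-- Congruences modulo the prime p = 2n + 1

module OddPrime (n : ℕ) (p-prime : Prime (suc (n ℕ.+ n))) (1<n : 1 ℕ.< n) where

  p : ℕ
  p = suc (n ℕ.+ n)

  infix 4 _≋_

  record _≋_ (a b : ℤ) : Set where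
    constructor congruent-mod
    field
      p∣difference : + p ∣ a - b

  ≋-reflexive : ∀ {a b} → a ≡ b → a ≋ b
  ≋-reflexive {a} refl = congruent-mod (divides 0ℤ (ℤ.+-inverseʳ a))

  ≋-refl : ∀ {a} → a ≋ a
  ≋-refl = ≋-reflexive refl

  ≋-sym : ∀ {a b} → a ≋ b → b ≋ a
  ≋-sym {a} {b} (congruent-mod d) = congruent-mod (subst (+ p ∣_) (lemma a b) (∣m⇒∣-m d))
    where
    lemma : ∀ a b → - (a - b) ≡ b - a
    lemma = solve-∀

  ≋-trans : ∀ {a b c} → a ≋ b → b ≋ c → a ≋ c
  ≋-trans {a} {b} {c} (congruent-mod d) (congruent-mod e) =
    congruent-mod (subst (+ p ∣_) (lemma a b c) (∣m∣n⇒∣m+n d e))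
    where
    lemma : ∀ a b c → (a - b) + (b - c) ≡ a - c
    lemma = solve-∀

  ≋-setoid : Setoid _ _
  ≋-setoid = record
    { Carrier       = ℤ
    ; _≈_           = _≋_
    ; isEquivalence = record { refl = ≋-refl ; sym = ≋-sym ; trans = ≋-trans }
    }

  open SetoidReasoning ≋-setoid

  +-cong : ∀ {a b c d} → a ≋ b → c ≋ d → a + c ≋ b + d
  +-cong {a} {b} {c} {d} (congruent-mod e) (congruent-mod f) =
    congruent-mod (subst (+ p ∣_) (lemma a b c d) (∣m∣n⇒∣m+n e f))
    where
    lemma : ∀ a b c d → (a - b) + (c - d) ≡ (a + c) - (b + d)
    lemma = solve-∀

  *-cong : ∀ {a b c d} → a ≋ b → c ≋ d → a * c ≋ b * d
  *-cong {a} {b} {c} {d} (congruent-mod e) (congruent-mod f) =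
    congruent-mod (subst (+ p ∣_) (lemma a b c d) (∣m∣n⇒∣m+n (∣m⇒∣m*n c e) (∣n⇒∣m*n b f)))
    where
    lemma : ∀ a b c d → (a - b) * c + b * (c - d) ≡ a * c - b * d
    lemma = solve-∀

  +-congˡ : ∀ {a b} c → a ≋ b → c + a ≋ c + b
  +-congˡ c = +-cong (≋-refl {c})

  *-congˡ : ∀ {a b} c → a ≋ b → c * a ≋ c * b
  *-congˡ c = *-cong (≋-refl {c})

  *-congʳ : ∀ {a b} c → a ≋ b → a * c ≋ b * c
  *-congʳ c a≋b = *-cong a≋b (≋-refl {c})

  -‿cong : ∀ {a b} → a ≋ b → - a ≋ - b
  -‿cong {a} {b} (congruent-mod e) = congruent-mod (subst (+ p ∣_) (lemma a b) (∣m⇒∣-m e))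
    where
    lemma : ∀ a b → - (a - b) ≡ - a - - b
    lemma = solve-∀

  ^-cong : ∀ {a b} k → a ≋ b → a ^ k ≋ b ^ k
  ^-cong zero    a≋b = ≋-refl
  ^-cong (suc k) a≋b = *-cong a≋b (^-cong k a≋b)

  ∣⇒≋0 : ∀ {a} → + p ∣ a → a ≋ 0ℤ
  ∣⇒≋0 {a} d = congruent-mod (subst (+ p ∣_) (sym (ℤ.+-identityʳ a)) d)

  ≋0⇒∣ : ∀ {a} → a ≋ 0ℤ → + p ∣ a
  ≋0⇒∣ {a} (congruent-mod d) = subst (+ p ∣_) (ℤ.+-identityʳ a) d

  difference≋0⇒≋ : ∀ {a b} → a - b ≋ 0ℤ → a ≋ b
  difference≋0⇒≋ = congruent-mod ∘ ≋0⇒∣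

  p≋0 : + p ≋ 0ℤ
  p≋0 = ∣⇒≋0 (divides 1ℤ (sym (ℤ.*-identityˡ (+ p))))

  ∑-cong-≋ : ∀ m {f g : ℕ → ℤ} → (∀ k → k ℕ.< m → f k ≋ g k) → ∑< m f ≋ ∑< m g
  ∑-cong-≋ zero    f≋g = ≋-reflexive (trans (∑-empty _) (sym (∑-empty _)))
  ∑-cong-≋ (suc m) {f} {g} f≋g = begin
    ∑< (suc m) f        ≡⟨ ∑-last m f ⟩
    ∑< m f + f m        ≈⟨ +-cong (∑-cong-≋ m λ k k<m → f≋g k (ℕ.m<n⇒m<1+n k<m)) (f≋g m (ℕ.n<1+n m)) ⟩
    ∑< m g + g m        ≡⟨ ∑-last m g ⟨
    ∑< (suc m) g        ∎

  ∑-vanishing : ∀ m {f : ℕ → ℤ} → (∀ k → k ℕ.< m → f k ≋ 0ℤ) → ∑< m f ≋ 0ℤ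
  ∑-vanishing m {f} f≋0 = begin
    ∑< m f        ≈⟨ ∑-cong-≋ m f≋0 ⟩
    (∑[ _ < m ] 0ℤ) ≡⟨ ∑-const m 0ℤ ⟩
    + m * 0ℤ      ≡⟨ ℤ.*-zeroʳ (+ m) ⟩
    0ℤ            ∎

  ∑-single : ∀ m i {f : ℕ → ℤ} → i ℕ.< m → (∀ k → k ℕ.< m → k ≢ i → f k ≋ 0ℤ) → ∑< m f ≋ f i
  ∑-single (suc m) zero {f} _ f≋0 = begin
    ∑< (suc m) f             ≡⟨ ∑-first m f ⟩
    f 0 + ∑< m (f ∘ suc)     ≈⟨ +-congˡ (f 0) (∑-vanishing m λ k k<m → f≋0 (suc k) (s≤s k<m) λ ()) ⟩
    f 0 + 0ℤ                 ≡⟨ ℤ.+-identityʳ (f 0) ⟩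
    f 0                      ∎
  ∑-single (suc m) (suc i) {f} (s≤s i<m) f≋0 = begin
    ∑< (suc m) f             ≡⟨ ∑-first m f ⟩
    f 0 + ∑< m (f ∘ suc)     ≈⟨ +-cong (f≋0 0 (s≤s z≤n) λ ())
                                  (∑-single m i i<m λ k k<m k≢i → f≋0 (suc k) (s≤s k<m) (k≢i ∘ ℕ.suc-injective)) ⟩
    0ℤ + f (suc i)           ≡⟨ ℤ.+-identityˡ (f (suc i)) ⟩
    f (suc i)                ∎

  *≋0 : ∀ a b → a * b ≋ 0ℤ → a ≋ 0ℤ ⊎ b ≋ 0ℤ
  *≋0 a b ab≋0 = Sum.map (∣⇒≋0 ∘ ∣ᵤ⇒∣) (∣⇒≋0 ∘ ∣ᵤ⇒∣)
    (euclidsLemma ℤ.∣ a ∣ ℤ.∣ b ∣ p-prime (subst (p ℕ.∣_) (ℤ.abs-* a b) (∣⇒∣ᵤ (≋0⇒∣ ab≋0))))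

  *≉0 : ∀ {a b} → ¬ a ≋ 0ℤ → ¬ b ≋ 0ℤ → ¬ a * b ≋ 0ℤ
  *≉0 {a} {b} a≉0 b≉0 ab≋0 = Sum.[ a≉0 , b≉0 ] (*≋0 a b ab≋0)

  *≋0-cancelˡ : ∀ {a b} → ¬ a ≋ 0ℤ → a * b ≋ 0ℤ → b ≋ 0ℤ
  *≋0-cancelˡ {a} {b} a≉0 ab≋0 = Sum.fromInj₂ (λ a≋0 → contradiction a≋0 a≉0) (*≋0 a b ab≋0)

  *-cancelˡ : ∀ c {a b} → ¬ c ≋ 0ℤ → c * a ≋ c * b → a ≋ b
  *-cancelˡ c {a} {b} c≉0 (congruent-mod d) =
    difference≋0⇒≋ (*≋0-cancelˡ {c} c≉0 (∣⇒≋0 (subst (+ p ∣_) (lemma c a b) d)))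
    where
    lemma : ∀ c a b → c * a - c * b ≡ c * (a - b)
    lemma = solve-∀

  small≉0 : ∀ k → suc k ℕ.< p → ¬ + suc k ≋ 0ℤ
  small≉0 k 1+k<p k≋0 = ℕ.>⇒∤ 1+k<p (∣⇒∣ᵤ (≋0⇒∣ k≋0))

  1≉0 : ¬ 1ℤ ≋ 0ℤ
  1≉0 = small≉0 0 (s≤s (ℕ.≤-trans (ℕ.<⇒≤ 1<n) (ℕ.m≤m+n n n)))

  ^≉0 : ∀ {a} k → ¬ a ≋ 0ℤ → ¬ a ^ k ≋ 0ℤ
  ^≉0 zero    a≉0 = 1≉0
  ^≉0 (suc k) a≉0 = *≉0 a≉0 (^≉0 k a≉0)

  -- Frobenius and Fermat

  binom-p≋0 : ∀ k → suc k ℕ.< p → binom p (suc k) ≋ 0ℤ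
  binom-p≋0 k 1+k<p = *≋0-cancelˡ {+ suc k} (small≉0 k 1+k<p) (begin
    + suc k * binom p (suc k)   ≡⟨ binom-absorption (n ℕ.+ n) k ⟩
    + p * binom (n ℕ.+ n) k     ≈⟨ *-congʳ (binom (n ℕ.+ n) k) p≋0 ⟩
    0ℤ * binom (n ℕ.+ n) k      ≡⟨ ℤ.*-zeroˡ (binom (n ℕ.+ n) k) ⟩
    0ℤ                          ∎)

  frobenius : ∀ w → binomialSum p w ≋ w 0 p + w p 0
  frobenius w = begin
    binomialSum p w
      ≡⟨ ∑-last p (λ k → binom p k * w k (p ∸ k)) ⟩
    (∑[ k < p ] binom p k * w k (p ∸ k)) + binom p p * w p (p ∸ p)
      ≈⟨ +-cong (∑-single p 0 {λ k → binom p k * w k (p ∸ k)} (s≤s z≤n) vanishing)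
           (≋-reflexive (cong₂ _*_ (binom-n-n p) (cong (w p) (ℕ.n∸n≡0 p)))) ⟩
    binom p 0 * w 0 p + 1ℤ * w p 0
      ≡⟨ cong₂ _+_ (trans (cong (_* w 0 p) (binom-n-0 p)) (ℤ.*-identityˡ (w 0 p))) (ℤ.*-identityˡ (w p 0)) ⟩
    w 0 p + w p 0 ∎
    where
    vanishing : ∀ k → k ℕ.< p → k ≢ 0 → binom p k * w k (p ∸ k) ≋ 0ℤ
    vanishing zero    _   0≢0 = contradiction refl 0≢0
    vanishing (suc k) k<p _   = begin
      binom p (suc k) * w (suc k) (p ∸ suc k)  ≈⟨ *-congʳ (w (suc k) (p ∸ suc k)) (binom-p≋0 k k<p) ⟩
      0ℤ * w (suc k) (p ∸ suc k)               ≡⟨ ℤ.*-zeroˡ (w (suc k) (p ∸ suc k)) ⟩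
      0ℤ ∎

  frobenius-suc : ∀ x → (x + 1ℤ) ^ p ≋ x ^ p + 1ℤ
  frobenius-suc x = begin
    (x + 1ℤ) ^ p                               ≡⟨ binomial-theorem p x 1ℤ ⟩
    binomialSum p (λ i j → x ^ i * 1ℤ ^ j)     ≈⟨ frobenius (λ i j → x ^ i * 1ℤ ^ j) ⟩
    1ℤ * 1ℤ ^ p + x ^ p * 1ℤ                   ≡⟨ cong₂ _+_ (trans (ℤ.*-identityˡ (1ℤ ^ p)) (ℤ.^-zeroˡ p)) (ℤ.*-identityʳ (x ^ p)) ⟩
    1ℤ + x ^ p                                 ≡⟨ ℤ.+-comm 1ℤ (x ^ p) ⟩
    x ^ p + 1ℤ                                 ∎

  fermat : ∀ x → x ^ p ≋ x
  fermat (+ zero)       = ≋-reflexive (ℤ.*-zeroˡ (0ℤ ^ (n ℕ.+ n)))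
  fermat (+ suc m)      = begin
    (+ suc m) ^ p       ≡⟨ cong (_^ p) (ℤ.+-comm 1ℤ (+ m)) ⟩
    (+ m + 1ℤ) ^ p      ≈⟨ frobenius-suc (+ m) ⟩
    (+ m) ^ p + 1ℤ      ≈⟨ +-cong (fermat (+ m)) ≋-refl ⟩
    + m + 1ℤ            ≡⟨ ℤ.+-comm (+ m) 1ℤ ⟩
    + suc m             ∎
  -- Downward induction: the step x ↦ x + 1 is reversible, and adding 1 to a negative integer gives
  -- 0 or the preceding case.
  fermat -[1+ m ]       = +-cancelʳ (begin
    -[1+ m ] ^ p + 1ℤ   ≈⟨ frobenius-suc -[1+ m ] ⟨
    (-[1+ m ] + 1ℤ) ^ p ≈⟨ previous m ⟩
    -[1+ m ] + 1ℤ       ∎)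
    where
    previous : ∀ m → (-[1+ m ] + 1ℤ) ^ p ≋ -[1+ m ] + 1ℤ
    previous zero    = fermat 0ℤ
    previous (suc m) = fermat -[1+ m ]
    +-cancelʳ : ∀ {a b} → a + 1ℤ ≋ b + 1ℤ → a ≋ b
    +-cancelʳ {a} {b} (congruent-mod d) = congruent-mod (subst (+ p ∣_) (lemma a b) d)
      where
      lemma : ∀ a b → a + 1ℤ - (b + 1ℤ) ≡ a - b
      lemma = solve-∀

  fermat-unit : ∀ {x} → ¬ x ≋ 0ℤ → x ^ (n ℕ.+ n) ≋ 1ℤ
  fermat-unit {x} x≉0 = *-cancelˡ x x≉0 (≋-trans (fermat x) (≋-reflexive (sym (ℤ.*-identityʳ x))))

  -- Power sums

  powerSum : ℕ → ℤ
  powerSum j = ∑[ x < p ] (+ x) ^ j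

  0<2n : 0 ℕ.< n ℕ.+ n
  0<2n = ℕ.≤-trans (ℕ.<⇒≤ 1<n) (ℕ.m≤m+n n n)

  -- Summing (x + 1)ʲ⁺¹ - xʲ⁺¹ over the residues telescopes to a multiple of p. Expanded, it is a
  -- combination of power sums in which all exponents below j vanish by induction, leaving (j + 1)
  -- times the sum for j, and 0 < j + 1 < p. This avoids primitive roots; j = 0 is included, with 0⁰
  -- = 1.
  powerSum≋0 : ∀ j → j ℕ.< n ℕ.+ n → powerSum j ≋ 0ℤ
  powerSum≋0 = <-rec (λ j → j ℕ.< n ℕ.+ n → powerSum j ≋ 0ℤ) step
    where
    step : ∀ j → (∀ {i} → i ℕ.< j → i ℕ.< n ℕ.+ n → powerSum i ≋ 0ℤ) → j ℕ.< n ℕ.+ n → powerSum j ≋ 0ℤ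
    step j powerSumᵢ≋0 j<2n = *≋0-cancelˡ {+ suc j} (small≉0 j (s≤s j<2n)) product≋0
      where
      binom-suc-j-j : binom (suc j) j ≡ + suc j
      binom-suc-j-j = trans (binom-sym {suc j} {1} (s≤s z≤n)) (binom-n-1 (suc j))
      lower-terms : (∑[ k < j ] binom (suc j) k * powerSum k) ≋ 0ℤ
      lower-terms = ∑-vanishing j λ k k<j → begin
        binom (suc j) k * powerSum k  ≈⟨ *-congˡ (binom (suc j) k) (powerSumᵢ≋0 k<j (ℕ.<-trans k<j j<2n)) ⟩
        binom (suc j) k * 0ℤ          ≡⟨ ℤ.*-zeroʳ (binom (suc j) k) ⟩
        0ℤ                            ∎
      product≋0 : + suc j * powerSum j ≋ 0ℤ
      product≋0 = begin
        + suc j * powerSum j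
          ≡⟨ cong (_* powerSum j) binom-suc-j-j ⟨
        binom (suc j) j * powerSum j
          ≡⟨ ℤ.+-identityˡ _ ⟨
        0ℤ + binom (suc j) j * powerSum j
          ≈⟨ +-cong lower-terms ≋-refl ⟨
        (∑[ k < j ] binom (suc j) k * powerSum k) + binom (suc j) j * powerSum j
          ≡⟨ ∑-last j (λ k → binom (suc j) k * powerSum k) ⟨
        (∑[ k < suc j ] binom (suc j) k * powerSum k)
          ≡⟨ ∑-cong (suc j) (λ k _ → ∑-*ˡ p (binom (suc j) k) (λ x → (+ x) ^ k)) ⟩
        (∑[ k < suc j ] ∑[ x < p ] binom (suc j) k * (+ x) ^ k)
          ≡⟨ ∑-swap (suc j) p (λ k x → binom (suc j) k * (+ x) ^ k) ⟩
        (∑[ x < p ] ∑[ k < suc j ] binom (suc j) k * (+ x) ^ k)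
          ≡⟨ ∑-cong p (λ x _ → difference-power (+ x) j) ⟨
        (∑[ x < p ] (+ x + 1ℤ) ^ suc j - (+ x) ^ suc j)
          ≡⟨ ∑-cong p (λ x _ → cong (λ y → y ^ suc j - (+ x) ^ suc j) (ℤ.+-comm (+ x) 1ℤ)) ⟩
        (∑[ x < p ] (+ suc x) ^ suc j - (+ x) ^ suc j)
          ≡⟨ ∑-telescope p (λ x → (+ x) ^ suc j) ⟩
        (+ p) ^ suc j - 0ℤ ^ suc j
          ≈⟨ +-cong {(+ p) ^ suc j} {0ℤ ^ suc j} { - (0ℤ ^ suc j)} (^-cong {+ p} {0ℤ} (suc j) p≋0) ≋-refl ⟩
        0ℤ ^ suc j - 0ℤ ^ suc j
          ≡⟨ ℤ.+-inverseʳ (0ℤ ^ suc j) ⟩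
        0ℤ ∎

  powerSum-2n : powerSum (n ℕ.+ n) ≋ -1ℤ
  powerSum-2n = begin
    powerSum (n ℕ.+ n)
      ≡⟨ ∑-first (n ℕ.+ n) (λ x → (+ x) ^ (n ℕ.+ n)) ⟩
    0ℤ ^ (n ℕ.+ n) + (∑[ x < n ℕ.+ n ] (+ suc x) ^ (n ℕ.+ n))
      ≈⟨ +-cong (≋-reflexive (0^k≡0 (n ℕ.+ n) 0<2n)) (∑-cong-≋ (n ℕ.+ n) λ x x<2n → fermat-unit (small≉0 x (s≤s x<2n))) ⟩
    0ℤ + (∑[ _ < n ℕ.+ n ] 1ℤ)
      ≡⟨ trans (ℤ.+-identityˡ _) (trans (∑-const (n ℕ.+ n) 1ℤ) (ℤ.*-identityʳ _)) ⟩
    + (n ℕ.+ n)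
      ≡⟨ lemma (+ (n ℕ.+ n)) ⟩
    + p + -1ℤ
      ≈⟨ +-cong {+ p} {0ℤ} { -1ℤ} p≋0 ≋-refl ⟩
    -1ℤ ∎
    where
    lemma : ∀ a → a ≡ 1ℤ + a + -1ℤ
    lemma = solve-∀

  -- For j > 0 there is a factor x that completes x²ⁿ to xᵖ ≡ x. At j = 0 the period fails: the sums
  -- for 2n and 0 are -1 and 0.
  powerSum-period : ∀ j → 0 ℕ.< j → powerSum (j ℕ.+ (n ℕ.+ n)) ≋ powerSum j
  powerSum-period (suc j) _ = ∑-cong-≋ p λ x _ → begin
    (+ x) ^ (suc j ℕ.+ (n ℕ.+ n))  ≡⟨ cong ((+ x) ^_) (ℕ.+-suc j (n ℕ.+ n)) ⟨
    (+ x) ^ (j ℕ.+ p)              ≡⟨ ℤ.^-distribˡ-+-* (+ x) j p ⟩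
    (+ x) ^ j * (+ x) ^ p          ≈⟨ *-congˡ ((+ x) ^ j) (fermat (+ x)) ⟩
    (+ x) ^ j * + x                ≡⟨ ℤ.*-comm ((+ x) ^ j) (+ x) ⟩
    (+ x) ^ suc j                  ∎

  powerSum-4n : powerSum ((n ℕ.+ n) ℕ.+ (n ℕ.+ n)) ≋ -1ℤ
  powerSum-4n = ≋-trans (powerSum-period (n ℕ.+ n) 0<2n) powerSum-2n

  powerSum-vanishing : ∀ j → j ℕ.< (n ℕ.+ n) ℕ.+ (n ℕ.+ n) → j ≢ n ℕ.+ n → powerSum j ≋ 0ℤ
  powerSum-vanishing j j<4n j≢2n with ℕ.<-cmp j (n ℕ.+ n)
  ... | tri< j<2n _ _ = powerSum≋0 j j<2n
  ... | tri≈ _ j≡2n _ = contradiction j≡2n j≢2n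
  ... | tri> _ _ j>2n = begin
    powerSum j                                    ≡⟨ cong powerSum (ℕ.m∸n+n≡m (ℕ.<⇒≤ j>2n)) ⟨
    powerSum (j ∸ (n ℕ.+ n) ℕ.+ (n ℕ.+ n))        ≈⟨ powerSum-period (j ∸ (n ℕ.+ n)) (ℕ.m<n⇒0<n∸m j>2n) ⟩
    powerSum (j ∸ (n ℕ.+ n))                      ≈⟨ powerSum≋0 (j ∸ (n ℕ.+ n)) j-2n<2n ⟩
    0ℤ                                            ∎
    where
    j-2n<2n : j ∸ (n ℕ.+ n) ℕ.< n ℕ.+ n
    j-2n<2n = ℕ.+-cancelʳ-< (n ℕ.+ n) _ _ (subst (ℕ._< (n ℕ.+ n) ℕ.+ (n ℕ.+ n)) (sym (ℕ.m∸n+n≡m (ℕ.<⇒≤ j>2n))) j<4n)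

  ∑-powers : ∀ m (c : ℕ → ℤ) (e : ℕ → ℕ) →
    (∑[ x < p ] ∑[ k < m ] c k * (+ x) ^ e k) ≡ ∑[ k < m ] c k * powerSum (e k)
  ∑-powers m c e = trans (∑-swap p m (λ x k → c k * (+ x) ^ e k))
    (∑-cong m λ k _ → sym (∑-*ˡ p (c k) (λ x → (+ x) ^ e k)))

  -- The Legendre symbol and Euler's criterion

  -- Indexed by the value of the symbol, so that each case determines it. The modulus `q` is
  -- arbitrary because symbols modulo 3 occur as well as symbols modulo p.
  data LegendreView (a : ℤ) (q : ℕ) : ℤ → Set where
    divisible  : + q ∣ a → LegendreView a q 0ℤ
    residue    : ¬ + q ∣ a → (x : Fin q) → + q ∣ (+ toℕ x) ^ 2 - a → LegendreView a q 1ℤ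
    nonresidue : ¬ + q ∣ a → (∀ (x : Fin q) → ¬ + q ∣ (+ toℕ x) ^ 2 - a) → LegendreView a q -1ℤ

  legendre-view : ∀ a q → LegendreView a q (legendre a q)
  legendre-view a q = view (+ q ∣? a) (Fin.any? {n = q} λ x → + q ∣? ((+ toℕ x) ^ 2 - a))
    where
    view : (d : Dec (+ q ∣ a)) (e : Dec (∃ λ (x : Fin q) → + q ∣ (+ toℕ x) ^ 2 - a)) →
           LegendreView a q (if does d then 0ℤ else if does e then 1ℤ else -1ℤ)
    view (yes q∣a) _             = divisible q∣a
    view (no  q∤a) (yes (x , r)) = residue q∤a x r
    view (no  q∤a) (no  ¬r)      = nonresidue q∤a λ x r → ¬r (x , r)

  -- Neighbours in row p - 1 of Pascal's triangle add up to an inner entry of row p, which is ≡ 0,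
  -- so the signs alternate from C(p - 1,0) = 1.
  binom-2n : ∀ k → k ℕ.≤ n ℕ.+ n → binom (n ℕ.+ n) k ≋ -1ℤ ^ k
  binom-2n zero    _    = ≋-reflexive (binom-n-0 (n ℕ.+ n))
  binom-2n (suc k) k<2n = begin
    binom (n ℕ.+ n) (suc k)
      ≡⟨ lemma (binom (n ℕ.+ n) k) (binom (n ℕ.+ n) (suc k)) ⟩
    binom (n ℕ.+ n) k + binom (n ℕ.+ n) (suc k) - binom (n ℕ.+ n) k
      ≡⟨ cong (_- binom (n ℕ.+ n) k) (binom-pascal (n ℕ.+ n) k) ⟨
    binom p (suc k) + - binom (n ℕ.+ n) k
      ≈⟨ +-cong (binom-p≋0 k (s≤s k<2n)) (-‿cong (binom-2n k (ℕ.<⇒≤ k<2n))) ⟩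
    0ℤ + - (-1ℤ ^ k)
      ≡⟨ negate (-1ℤ ^ k) ⟩
    -1ℤ ^ suc k ∎
    where
    lemma : ∀ a b → b ≡ a + b - a
    lemma = solve-∀
    negate : ∀ a → 0ℤ + - a ≡ -1ℤ * a
    negate = solve-∀

  -- The degree is exactly 4n, so two exponents survive: x²ⁿ contributes -C(2n,n)(-a)ⁿ ≡ -aⁿ, the
  -- two signs (-1)ⁿ cancelling, and the leading x⁴ⁿ contributes -1.
  ∑[x²-a]²ⁿ : ∀ a → (∑[ x < p ] ((+ x) ^ 2 - a) ^ (n ℕ.+ n)) ≋ - (a ^ n + 1ℤ)
  ∑[x²-a]²ⁿ a = begin
    (∑[ x < p ] ((+ x) ^ 2 - a) ^ (n ℕ.+ n))
      ≡⟨ ∑-cong p (λ x _ → expand (+ x)) ⟩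
    (∑[ x < p ] ∑[ k < suc (n ℕ.+ n) ] c k * (+ x) ^ (2 ℕ.* k))
      ≡⟨ ∑-powers (suc (n ℕ.+ n)) c (2 ℕ.*_) ⟩
    (∑[ k < suc (n ℕ.+ n) ] c k * powerSum (2 ℕ.* k))
      ≡⟨ ∑-last (n ℕ.+ n) (λ k → c k * powerSum (2 ℕ.* k)) ⟩
    (∑[ k < n ℕ.+ n ] c k * powerSum (2 ℕ.* k)) + c (n ℕ.+ n) * powerSum (2 ℕ.* (n ℕ.+ n))
      ≈⟨ +-cong (∑-single (n ℕ.+ n) n {λ k → c k * powerSum (2 ℕ.* k)} n<2n vanishing) (*-cong top S₄ₙ) ⟩
    c n * powerSum (2 ℕ.* n) + 1ℤ * -1ℤ
      ≈⟨ +-cong (*-cong middle (≋-trans (≋-reflexive (cong powerSum (2*k≡k+k n))) powerSum-2n)) (≋-refl { -1ℤ}) ⟩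
    a ^ n * -1ℤ + -1ℤ
      ≡⟨ lemma (a ^ n) ⟩
    - (a ^ n + 1ℤ) ∎
    where
    c : ℕ → ℤ
    c k = binom (n ℕ.+ n) k * (- a) ^ (n ℕ.+ n ∸ k)
    2*k≡k+k : ∀ k → 2 ℕ.* k ≡ k ℕ.+ k
    2*k≡k+k k = cong (k ℕ.+_) (ℕ.+-identityʳ k)
    swap : ∀ a b c → a * (b * c) ≡ a * c * b
    swap = solve-∀
    expand : ∀ x → (x ^ 2 - a) ^ (n ℕ.+ n) ≡ ∑[ k < suc (n ℕ.+ n) ] c k * x ^ (2 ℕ.* k)
    expand x = trans (binomial-theorem (n ℕ.+ n) (x ^ 2) (- a)) (∑-cong (suc (n ℕ.+ n)) λ k _ →
      trans (swap (binom (n ℕ.+ n) k) ((x ^ 2) ^ k) ((- a) ^ (n ℕ.+ n ∸ k)))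
        (cong (c k *_) (ℤ.^-*-assoc x 2 k)))
    n<2n : n ℕ.< n ℕ.+ n
    n<2n = ℕ.m<m+n n (ℕ.<⇒≤ 1<n)
    top : c (n ℕ.+ n) ≋ 1ℤ
    top = ≋-reflexive (cong₂ _*_ (binom-n-n (n ℕ.+ n)) (cong ((- a) ^_) (ℕ.n∸n≡0 (n ℕ.+ n))))
    S₄ₙ : powerSum (2 ℕ.* (n ℕ.+ n)) ≋ -1ℤ
    S₄ₙ = ≋-trans (≋-reflexive (cong powerSum (2*k≡k+k (n ℕ.+ n)))) powerSum-4n
    middle : c n ≋ a ^ n
    middle = begin
      binom (n ℕ.+ n) n * (- a) ^ (n ℕ.+ n ∸ n)
        ≈⟨ *-cong (binom-2n n (ℕ.<⇒≤ n<2n)) (≋-reflexive (cong ((- a) ^_) (ℕ.m+n∸n≡m n n))) ⟩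
      -1ℤ ^ n * (- a) ^ n
        ≡⟨ ^-distribʳ-* -1ℤ (- a) n ⟨
      (-1ℤ * - a) ^ n
        ≡⟨ cong (_^ n) (double-negation a) ⟩
      a ^ n ∎
      where
      double-negation : ∀ a → -1ℤ * - a ≡ a
      double-negation = solve-∀
    vanishing : ∀ k → k ℕ.< n ℕ.+ n → k ≢ n → c k * powerSum (2 ℕ.* k) ≋ 0ℤ
    vanishing k k<2n k≢n = begin
      c k * powerSum (2 ℕ.* k)  ≡⟨ cong (λ i → c k * powerSum i) (2*k≡k+k k) ⟩
      c k * powerSum (k ℕ.+ k)  ≈⟨ *-congˡ (c k) (powerSum-vanishing (k ℕ.+ k) (ℕ.+-mono-< k<2n k<2n) 2k≢2n) ⟩
      c k * 0ℤ                  ≡⟨ ℤ.*-zeroʳ (c k) ⟩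
      0ℤ                        ∎
      where
      2k≢2n : k ℕ.+ k ≢ n ℕ.+ n
      2k≢2n eq = k≢n (ℕ.*-cancelˡ-≡ k n 2 (trans (2*k≡k+k k) (trans eq (sym (2*k≡k+k n)))))
    lemma : ∀ a → a * -1ℤ + -1ℤ ≡ - (a + 1ℤ)
    lemma = solve-∀

  euler-nonresidue : ∀ a → (∀ x → x ℕ.< p → ¬ (+ x) ^ 2 - a ≋ 0ℤ) → a ^ n ≋ -1ℤ
  euler-nonresidue a no-root = difference≋0⇒≋ (begin
    a ^ n - -1ℤ                               ≡⟨ lemma (a ^ n) ⟩
    - (- (a ^ n + 1ℤ))                        ≈⟨ -‿cong (∑[x²-a]²ⁿ a) ⟨
    - (∑[ x < p ] ((+ x) ^ 2 - a) ^ (n ℕ.+ n)) ≈⟨ -‿cong (∑-cong-≋ p λ x x<p → fermat-unit (no-root x x<p)) ⟩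
    - (∑[ x < p ] 1ℤ)                         ≡⟨ cong -_ (trans (∑-const p 1ℤ) (ℤ.*-identityʳ (+ p))) ⟩
    - (+ p)                                   ≈⟨ -‿cong p≋0 ⟩
    0ℤ                                        ∎)
    where
    lemma : ∀ b → b - -1ℤ ≡ - (- (b + 1ℤ))
    lemma = solve-∀

  0<n : 0 ℕ.< n
  0<n = ℕ.<⇒≤ 1<n

  euler-residue : ∀ {a} x → ¬ a ≋ 0ℤ → x ^ 2 ≋ a → a ^ n ≋ 1ℤ
  euler-residue {a} x a≉0 x²≋a = begin
    a ^ n          ≈⟨ ^-cong n x²≋a ⟨
    (x ^ 2) ^ n    ≡⟨ ℤ.^-*-assoc x 2 n ⟩
    x ^ (n ℕ.+ (n ℕ.+ 0)) ≡⟨ cong (λ k → x ^ (n ℕ.+ k)) (ℕ.+-identityʳ n) ⟩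
    x ^ (n ℕ.+ n)  ≈⟨ fermat-unit (λ x≋0 → a≉0 (≋-trans (≋-sym x²≋a) (^-cong {x} {0ℤ} 2 x≋0))) ⟩
    1ℤ             ∎

  ^n≋0 : ∀ {a} → a ≋ 0ℤ → a ^ n ≋ 0ℤ
  ^n≋0 {a} a≋0 = ≋-trans (^-cong n a≋0) (≋-reflexive (0^k≡0 n 0<n))

  euler-criterion : ∀ a → legendre a p ≋ a ^ n
  euler-criterion a = cases (legendre-view a p)
    where
    cases : ∀ {l} → LegendreView a p l → l ≋ a ^ n
    cases (divisible p∣a)      = ≋-sym (^n≋0 (∣⇒≋0 p∣a))
    cases (residue p∤a x r)    = ≋-sym (euler-residue (+ toℕ x) (p∤a ∘ ≋0⇒∣) (congruent-mod r))
    cases (nonresidue p∤a ¬r)  = ≋-sym (euler-nonresidue a λ x x<p x²-a≋0 → ¬r (fromℕ< x<p)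
      (subst (λ y → + p ∣ (+ y) ^ 2 - a) (sym (Fin.toℕ-fromℕ< x<p)) (≋0⇒∣ x²-a≋0)))

  -- The quadratic character of -3.  In (1 + √-3)ᵐ = rational m + imaginary m √-3 the coefficient
  -- imaginary p is ≡ (-3)ⁿ by Frobenius, while (1 + √-3)³ = -8 computes it from p mod 3.

  sqrt-power : ℕ → ℤ
  sqrt-power zero          = 0ℤ
  sqrt-power (suc zero)    = 1ℤ
  sqrt-power (suc (suc i)) = - + 3 * sqrt-power i

  sqrt-power-odd : ∀ k → sqrt-power (suc (k ℕ.+ k)) ≡ (- + 3) ^ k
  sqrt-power-odd zero    = refl
  sqrt-power-odd (suc k) = trans (cong (λ j → sqrt-power (suc (suc j))) (ℕ.+-suc k k)) (cong (- + 3 *_) (sqrt-power-odd k))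

  -- `sqrt-power i` is the coefficient of √-3 in (√-3)ⁱ. The rational part of (√-3)ⁱ is the
  -- coefficient of √-3 one power later, hence the shifted index in `rational`.
  imaginary rational : ℕ → ℤ
  imaginary m = binomialSum m λ i _ → sqrt-power i
  rational m    = binomialSum m λ i _ → sqrt-power (suc i)

  imaginary-suc : ∀ m → imaginary (suc m) ≡ rational m + imaginary m
  imaginary-suc m = binomialSum-suc m λ i _ → sqrt-power i

  rational-suc : ∀ m → rational (suc m) ≡ - + 3 * imaginary m + rational m
  rational-suc m = trans (binomialSum-suc m λ i _ → sqrt-power (suc i))
    (cong (_+ rational m) (sym (binomialSum-*ˡ m (- + 3) λ i _ → sqrt-power i)))

  imaginary-3+ : ∀ m → imaginary (3 ℕ.+ m) ≡ - + 8 * imaginary m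
  imaginary-3+ m = trans (imaginary-suc (2 ℕ.+ m)) (trans (cong₂ _+_ rational₂ imaginary₂) (lemma (imaginary m) (rational m)))
    where
    imaginary₂ : imaginary (2 ℕ.+ m) ≡ (- + 3 * imaginary m + rational m) + (rational m + imaginary m)
    imaginary₂ = trans (imaginary-suc (suc m)) (cong₂ _+_ (rational-suc m) (imaginary-suc m))
    rational₂ : rational (2 ℕ.+ m) ≡ - + 3 * (rational m + imaginary m) + (- + 3 * imaginary m + rational m)
    rational₂ = trans (rational-suc (suc m)) (cong₂ (λ e f → - + 3 * e + f) (imaginary-suc m) (rational-suc m))
    lemma : ∀ e f → - + 3 * (f + e) + (- + 3 * e + f) + ((- + 3 * e + f) + (f + e)) ≡ - + 8 * e
    lemma = solve-∀

  imaginary-3* : ∀ q r → imaginary (q ℕ.* 3 ℕ.+ r) ≡ (- + 8) ^ q * imaginary r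
  imaginary-3* zero    r = sym (ℤ.*-identityˡ (imaginary r))
  imaginary-3* (suc q) r = trans (imaginary-3+ (q ℕ.* 3 ℕ.+ r))
    (trans (cong (- + 8 *_) (imaginary-3* q r)) (sym (ℤ.*-assoc (- + 8) ((- + 8) ^ q) (imaginary r))))

  imaginary-p : imaginary p ≋ (- + 3) ^ n
  imaginary-p = begin
    imaginary p             ≈⟨ frobenius (λ i _ → sqrt-power i) ⟩
    0ℤ + sqrt-power p             ≡⟨ trans (ℤ.+-identityˡ (sqrt-power p)) (sqrt-power-odd n) ⟩
    (- + 3) ^ n              ∎

  imaginary-0 : imaginary 0 ≡ 0ℤ
  imaginary-0 = trans (∑-first 0 _) (cong₂ _+_ (ℤ.*-zeroʳ (binom 0 0)) (∑-empty _))

  rational-0 : rational 0 ≡ 1ℤ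
  rational-0 = trans (∑-first 0 _) (cong₂ _+_ (trans (ℤ.*-identityʳ (binom 0 0)) (binom-n-0 0)) (∑-empty _))

  imaginary-1 : imaginary 1 ≡ 1ℤ
  imaginary-1 = trans (imaginary-suc 0) (cong₂ _+_ rational-0 imaginary-0)

  imaginary-2 : imaginary 2 ≡ + 2
  imaginary-2 = trans (imaginary-suc 1) (cong₂ _+_ (trans (rational-suc 0)
    (cong₂ (λ e f → - + 3 * e + f) imaginary-0 rational-0)) imaginary-1)

  2<p : 2 ℕ.< p
  2<p = s≤s (ℕ.≤-trans 1<n (ℕ.m≤m+n n n))

  2≉0 : ¬ + 2 ≋ 0ℤ
  2≉0 = small≉0 1 2<p

  -2≉0 : ¬ - + 2 ≋ 0ℤ
  -2≉0 = 2≉0 ∘ -‿cong { - + 2} {0ℤ}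

  -8^q : ∀ q → (- + 8) ^ q ≡ (- + 2) ^ (q ℕ.* 3)
  -8^q q = trans (ℤ.^-*-assoc (- + 2) 3 q) (cong ((- + 2) ^_) (ℕ.*-comm 3 q))

  mod3 : ∀ m → ∃ λ q → ∃ λ (r : Fin 3) → m ≡ q ℕ.* 3 ℕ.+ toℕ r
  mod3 m = m / 3 , fromℕ< (m%n<n m 3) , trans (m≡m%n+[m/n]*n m 3)
    (trans (ℕ.+-comm (m % 3) (m / 3 ℕ.* 3)) (cong (m / 3 ℕ.* 3 ℕ.+_) (sym (Fin.toℕ-fromℕ< (m%n<n m 3)))))

  legendre-1-mod-3 : ∀ q {m l} → m ≡ q ℕ.* 3 ℕ.+ 1 → LegendreView (+ m) 3 l → l ≡ 1ℤ
  legendre-1-mod-3 q refl (divisible d) = contradiction (∣m+n∣m⇒∣n d (divides (+ q) (ℤ.pos-* q 3))) (from-no (+ 3 ∣? + 1))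
  legendre-1-mod-3 q refl (residue _ _ _) = refl
  legendre-1-mod-3 q refl (nonresidue _ ¬r) = contradiction
    (divides (- + q) (trans (cong (λ m → 1ℤ - m) (trans (ℤ.pos-+ (q ℕ.* 3) 1) (cong (_+ 1ℤ) (ℤ.pos-* q 3)))) (lemma (+ q)))) (¬r (Fin.suc Fin.zero))
    where
    lemma : ∀ q → 1ℤ - (q * + 3 + 1ℤ) ≡ - q * + 3
    lemma = solve-∀

  legendre-2-mod-3 : ∀ q {m l} → m ≡ q ℕ.* 3 ℕ.+ 2 → LegendreView (+ m) 3 l → l ≡ -1ℤ
  legendre-2-mod-3 q refl (divisible d) = contradiction (∣m+n∣m⇒∣n d (divides (+ q) (ℤ.pos-* q 3))) (from-no (+ 3 ∣? + 2))
  legendre-2-mod-3 q refl (nonresidue _ _) = refl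
  legendre-2-mod-3 q refl (residue _ x d) = contradiction
    (∣m+n∣m⇒∣n (subst (+ 3 ∣_) (trans (cong (λ m → (+ toℕ x) ^ 2 - m) (trans (ℤ.pos-+ (q ℕ.* 3) 2) (cong (_+ + 2) (ℤ.pos-* q 3)))) (lemma (+ q) ((+ toℕ x) ^ 2))) d)
      (divides (- + q) refl)) (not-square x)
    where
    lemma : ∀ q y → y - (q * + 3 + + 2) ≡ - q * + 3 + (y - + 2)
    lemma = solve-∀
    not-square : ∀ (x : Fin 3) → ¬ + 3 ∣ (+ toℕ x) ^ 2 - + 2
    not-square Fin.zero                    = from-no (+ 3 ∣? - + 2)
    not-square (Fin.suc Fin.zero)          = from-no (+ 3 ∣? - + 1)
    not-square (Fin.suc (Fin.suc Fin.zero)) = from-no (+ 3 ∣? + 2)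

  -- For p = 3q + 1 the coefficient is (-8)^q = (-2)^(p - 1), and for p = 3q + 2 it is 2(-8)^q =
  -- -(-2)^(p - 1). By Fermat these are 1 and -1, the values of (p/3).
  legendre[p/3] : ¬ 3 ℕ.∣ p → legendre (+ p) 3 ≋ (- + 3) ^ n
  legendre[p/3] 3∤p = cases (mod3 p)
    where
    cases : (∃ λ q → ∃ λ (r : Fin 3) → p ≡ q ℕ.* 3 ℕ.+ toℕ r) → legendre (+ p) 3 ≋ (- + 3) ^ n
    cases (q , Fin.zero , eq) = contradiction (ℕ.divides q (trans eq (ℕ.+-identityʳ (q ℕ.* 3)))) 3∤p
    cases (q , Fin.suc Fin.zero , eq) = begin
      legendre (+ p) 3             ≡⟨ legendre-1-mod-3 q eq (legendre-view (+ p) 3) ⟩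
      1ℤ                           ≈⟨ fermat-unit -2≉0 ⟨
      (- + 2) ^ (n ℕ.+ n)          ≡⟨ cong ((- + 2) ^_) (ℕ.suc-injective (trans eq (ℕ.+-comm (q ℕ.* 3) 1))) ⟩
      (- + 2) ^ (q ℕ.* 3)          ≡⟨ -8^q q ⟨
      (- + 8) ^ q                  ≡⟨ ℤ.*-identityʳ ((- + 8) ^ q) ⟨
      (- + 8) ^ q * 1ℤ             ≡⟨ cong ((- + 8) ^ q *_) imaginary-1 ⟨
      (- + 8) ^ q * imaginary 1   ≡⟨ imaginary-3* q 1 ⟨
      imaginary (q ℕ.* 3 ℕ.+ 1)   ≡⟨ cong imaginary eq ⟨
      imaginary p                 ≈⟨ imaginary-p ⟩
      (- + 3) ^ n                  ∎
    cases (q , Fin.suc (Fin.suc Fin.zero) , eq) = begin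
      legendre (+ p) 3             ≡⟨ legendre-2-mod-3 q eq (legendre-view (+ p) 3) ⟩
      -1ℤ                          ≈⟨ -‿cong (fermat-unit -2≉0) ⟨
      - ((- + 2) ^ (n ℕ.+ n))      ≡⟨ cong (λ k → - ((- + 2) ^ k)) (ℕ.suc-injective (trans eq (ℕ.+-comm (q ℕ.* 3) 2))) ⟩
      - ((- + 2) ^ suc (q ℕ.* 3))  ≡⟨ negate ((- + 2) ^ (q ℕ.* 3)) ⟩
      (- + 2) ^ (q ℕ.* 3) * + 2    ≡⟨ cong (_* + 2) (-8^q q) ⟨
      (- + 8) ^ q * + 2            ≡⟨ cong ((- + 8) ^ q *_) imaginary-2 ⟨
      (- + 8) ^ q * imaginary 2   ≡⟨ imaginary-3* q 2 ⟨
      imaginary (q ℕ.* 3 ℕ.+ 2)   ≡⟨ cong imaginary eq ⟨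
      imaginary p                 ≈⟨ imaginary-p ⟩
      (- + 3) ^ n                  ∎
      where
      negate : ∀ a → - (- + 2 * a) ≡ a * + 2
      negate = solve-∀

  -- Complete sums over residues

  -- The shift loses the term at 0 and gains the one at p, which lies in the same class.
  ∑-successor : ∀ (g : ℤ → ℤ) → (∀ {x y} → x ≋ y → g x ≋ g y) → (∑[ x < p ] g (+ suc x)) ≋ ∑[ x < p ] g (+ x)
  ∑-successor g g-cong = begin
    (∑[ x < p ] g (+ suc x))
      ≡⟨ lemma₁ (g 0ℤ) (∑[ x < p ] g (+ suc x)) ⟩
    g 0ℤ + (∑[ x < p ] g (+ suc x)) + - g 0ℤ
      ≡⟨ cong (_+ - g 0ℤ) (∑-first p (λ x → g (+ x))) ⟨
    (∑[ x < suc p ] g (+ x)) + - g 0ℤ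
      ≡⟨ cong (_+ - g 0ℤ) (∑-last p (λ x → g (+ x))) ⟩
    (∑[ x < p ] g (+ x)) + g (+ p) + - g 0ℤ
      ≈⟨ +-cong {c = - g 0ℤ} (+-congˡ (∑[ x < p ] g (+ x)) (g-cong p≋0)) ≋-refl ⟩
    (∑[ x < p ] g (+ x)) + g 0ℤ + - g 0ℤ
      ≡⟨ lemma₂ (g 0ℤ) (∑[ x < p ] g (+ x)) ⟩
    (∑[ x < p ] g (+ x)) ∎
    where
    lemma₁ : ∀ a b → b ≡ a + b + - a
    lemma₁ = solve-∀
    lemma₂ : ∀ a b → b + a + - a ≡ b
    lemma₂ = solve-∀

  ∑-shift-ℕ : ∀ (g : ℤ → ℤ) → (∀ {x y} → x ≋ y → g x ≋ g y) → ∀ c → (∑[ x < p ] g (+ x + + c)) ≋ ∑[ x < p ] g (+ x)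
  ∑-shift-ℕ g g-cong zero = ≋-reflexive (∑-cong p λ x _ → cong g (ℤ.+-identityʳ (+ x)))
  ∑-shift-ℕ g g-cong (suc c) = begin
    (∑[ x < p ] g (+ x + + suc c))  ≡⟨ ∑-cong p (λ x _ → cong (λ k → g (+ k)) (ℕ.+-suc x c)) ⟩
    (∑[ x < p ] g (+ suc x + + c))  ≈⟨ ∑-successor (λ y → g (y + + c)) (λ x≋y → g-cong (+-cong x≋y (≋-refl {+ c}))) ⟩
    (∑[ x < p ] g (+ x + + c))      ≈⟨ ∑-shift-ℕ g g-cong c ⟩
    (∑[ x < p ] g (+ x))            ∎
  ∑-shift : ∀ (g : ℤ → ℤ) → (∀ {x y} → x ≋ y → g x ≋ g y) → ∀ c → (∑[ x < p ] g (+ x + c)) ≋ ∑[ x < p ] g (+ x)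
  ∑-shift g g-cong (+ c)     = ∑-shift-ℕ g g-cong c
  -- The upward shift is applied to the function that is already shifted down, and the two shifts
  -- cancel.
  ∑-shift g g-cong -[1+ c ]  = begin
    (∑[ x < p ] g (+ x + -[1+ c ]))              ≈⟨ ∑-shift-ℕ (λ y → g (y + -[1+ c ]))
                                                      (λ x≋y → g-cong (+-cong x≋y (≋-refl { -[1+ c ]}))) (suc c) ⟨
    (∑[ x < p ] g (+ x + + suc c + -[1+ c ]))    ≡⟨ ∑-cong p (λ x _ → cong g (lemma (+ x) (+ suc c))) ⟩
    (∑[ x < p ] g (+ x))                         ∎
    where
    lemma : ∀ x c → x + c + - c ≡ x
    lemma = solve-∀

  ∑-power-shifted-power : ∀ m j M x → m ℕ.+ j ≡ n ℕ.+ n → m ℕ.+ M ℕ.< (n ℕ.+ n) ℕ.+ (n ℕ.+ n) →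
    (∑[ y < p ] (+ y) ^ m * (+ y + x) ^ M) ≋ - (binom M j * x ^ (M ∸ j))
  ∑-power-shifted-power m j M x m+j≡2n m+M<4n = begin
    (∑[ y < p ] (+ y) ^ m * (+ y + x) ^ M)
      ≡⟨ ∑-cong p (λ y _ → expand (+ y)) ⟩
    (∑[ y < p ] ∑[ k < suc M ] c k * (+ y) ^ (m ℕ.+ k))
      ≡⟨ ∑-powers (suc M) c (m ℕ.+_) ⟩
    (∑[ k < suc M ] c k * powerSum (m ℕ.+ k))
      ≈⟨ select (j ℕ.<? suc M) ⟩
    - c j ∎
    where
    c : ℕ → ℤ
    c k = binom M k * x ^ (M ∸ k)
    rearrange : ∀ a b c d → a * (b * (c * d)) ≡ b * d * (a * c)
    rearrange = solve-∀
    expand : ∀ y → y ^ m * (y + x) ^ M ≡ ∑[ k < suc M ] c k * y ^ (m ℕ.+ k)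
    expand y = trans (cong (y ^ m *_) (binomial-theorem M y x))
      (trans (∑-*ˡ (suc M) (y ^ m) (λ k → binom M k * (y ^ k * x ^ (M ∸ k))))
        (∑-cong (suc M) λ k _ → trans (rearrange (y ^ m) (binom M k) (y ^ k) (x ^ (M ∸ k)))
          (cong (c k *_) (sym (ℤ.^-distribˡ-+-* y m k)))))
    vanishing : ∀ k → k ℕ.< suc M → k ≢ j → c k * powerSum (m ℕ.+ k) ≋ 0ℤ
    vanishing k (s≤s k≤M) k≢j = ≋-trans
      (*-congˡ (c k) (powerSum-vanishing (m ℕ.+ k) (ℕ.≤-<-trans (ℕ.+-monoʳ-≤ m k≤M) m+M<4n)
        λ m+k≡2n → k≢j (ℕ.+-cancelˡ-≡ m k j (trans m+k≡2n (sym m+j≡2n)))))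
      (≋-reflexive (ℤ.*-zeroʳ (c k)))
    negate : ∀ a → a * -1ℤ ≡ - a
    negate = solve-∀
    select : Dec (j ℕ.< suc M) → (∑[ k < suc M ] c k * powerSum (m ℕ.+ k)) ≋ - c j
    select (yes j≤M) = begin
      (∑[ k < suc M ] c k * powerSum (m ℕ.+ k))  ≈⟨ ∑-single (suc M) j {λ k → c k * powerSum (m ℕ.+ k)} j≤M vanishing ⟩
      c j * powerSum (m ℕ.+ j)                   ≡⟨ cong (λ i → c j * powerSum i) m+j≡2n ⟩
      c j * powerSum (n ℕ.+ n)                   ≈⟨ *-congˡ (c j) powerSum-2n ⟩
      c j * -1ℤ                                  ≡⟨ negate (c j) ⟩
      - c j                                      ∎
    select (no j≰M) = begin
      (∑[ k < suc M ] c k * powerSum (m ℕ.+ k))  ≈⟨ ∑-vanishing (suc M) (λ k k≤M → vanishing k k≤M λ { refl → j≰M k≤M }) ⟩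
      0ℤ                                         ≡⟨⟩
      - (0ℤ * x ^ (M ∸ j))                       ≡⟨ cong (λ b → - (b * x ^ (M ∸ j))) (binom-zero (ℕ.≰⇒> (j≰M ∘ s≤s))) ⟨
      - c j                                      ∎

  3n<4n : n ℕ.+ (n ℕ.+ n) ℕ.< (n ℕ.+ n) ℕ.+ (n ℕ.+ n)
  3n<4n = ℕ.+-monoˡ-< (n ℕ.+ n) (ℕ.m<m+n n 0<n)

  -- This is K(t).
  squareSum : ℤ → ℤ
  squareSum t = ∑[ k < suc n ] binom n k * binom n k * t ^ k

  -- Expanding (x + a)ⁿ yields the terms C(n,i) aⁿ⁻ⁱ xⁿ⁺ⁱ(x + at)ⁿ. The coefficient of x²ⁿ in xⁿ⁺ⁱ(x
  -- + at)ⁿ is C(n,n - i)(at)ⁱ, so by symmetry the binomial coefficient is squared and the powers of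
  -- a combine to aⁿ.
  cubicSum : ∀ a t → (∑[ x < p ] (+ x * (+ x + a) * (+ x + a * t)) ^ n) ≋ - (a ^ n * squareSum t)
  cubicSum a t = begin
    (∑[ x < p ] (+ x * (+ x + a) * (+ x + b)) ^ n)
      ≡⟨ ∑-cong p (λ x _ → expand (+ x)) ⟩
    (∑[ x < p ] ∑[ i < suc n ] d i * ((+ x) ^ (n ℕ.+ i) * (+ x + b) ^ n))
      ≡⟨ ∑-swap p (suc n) (λ x i → d i * ((+ x) ^ (n ℕ.+ i) * (+ x + b) ^ n)) ⟩
    (∑[ i < suc n ] ∑[ x < p ] d i * ((+ x) ^ (n ℕ.+ i) * (+ x + b) ^ n))
      ≡⟨ ∑-cong (suc n) (λ i _ → ∑-*ˡ p (d i) (λ x → (+ x) ^ (n ℕ.+ i) * (+ x + b) ^ n)) ⟨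
    (∑[ i < suc n ] d i * (∑[ x < p ] (+ x) ^ (n ℕ.+ i) * (+ x + b) ^ n))
      ≈⟨ ∑-cong-≋ (suc n) inner ⟩
    (∑[ i < suc n ] - (a ^ n * (binom n i * binom n i * t ^ i)))
      ≡⟨ ∑-neg (suc n) (λ i → a ^ n * (binom n i * binom n i * t ^ i)) ⟩
    - (∑[ i < suc n ] a ^ n * (binom n i * binom n i * t ^ i))
      ≡⟨ cong -_ (∑-*ˡ (suc n) (a ^ n) (λ i → binom n i * binom n i * t ^ i)) ⟨
    - (a ^ n * squareSum t) ∎
    where
    b = a * t
    d : ℕ → ℤ
    d i = binom n i * a ^ (n ∸ i)
    rearrange : ∀ x y z c a → x * z * (c * (y * a)) ≡ c * a * (x * y * z)
    rearrange = solve-∀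
    expand : ∀ x → (x * (x + a) * (x + b)) ^ n ≡ ∑[ i < suc n ] d i * (x ^ (n ℕ.+ i) * (x + b) ^ n)
    expand x = trans (cong (_^ n) (swap x (x + a) (x + b))) (trans (^-distribʳ-* (x * (x + b)) (x + a) n)
      (trans (cong₂ _*_ (^-distribʳ-* x (x + b) n) (binomial-theorem n x a))
      (trans (∑-*ˡ (suc n) (x ^ n * (x + b) ^ n) (λ i → binom n i * (x ^ i * a ^ (n ∸ i))))
        (∑-cong (suc n) λ i _ → trans (rearrange (x ^ n) (x ^ i) ((x + b) ^ n) (binom n i) (a ^ (n ∸ i)))
          (cong (λ y → d i * (y * (x + b) ^ n)) (sym (ℤ.^-distribˡ-+-* x n i)))))))
      where
      swap : ∀ a b c → a * b * c ≡ a * c * b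
      swap = solve-∀
    collect : ∀ c u v w → c * u * - (c * (v * w)) ≡ - (u * v * (c * c * w))
    collect = solve-∀
    inner : ∀ i → i ℕ.< suc n → d i * (∑[ x < p ] (+ x) ^ (n ℕ.+ i) * (+ x + b) ^ n)
                  ≋ - (a ^ n * (binom n i * binom n i * t ^ i))
    inner i (s≤s i≤n) = begin
      d i * (∑[ x < p ] (+ x) ^ (n ℕ.+ i) * (+ x + b) ^ n)
        ≈⟨ *-congˡ (d i) (∑-power-shifted-power (n ℕ.+ i) (n ∸ i) n b
             (trans (ℕ.+-assoc n i (n ∸ i)) (cong (n ℕ.+_) (ℕ.m+[n∸m]≡n i≤n)))
             (ℕ.≤-<-trans (ℕ.+-monoˡ-≤ n (ℕ.+-monoʳ-≤ n i≤n)) (subst (ℕ._< (n ℕ.+ n) ℕ.+ (n ℕ.+ n)) (sym (ℕ.+-assoc n n n)) 3n<4n))) ⟩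
      d i * - (binom n (n ∸ i) * b ^ (n ∸ (n ∸ i)))
        ≡⟨ cong₂ (λ c k → d i * - (c * b ^ k)) (binom-sym i≤n) (ℕ.m∸[m∸n]≡n i≤n) ⟩
      d i * - (binom n i * b ^ i)
        ≡⟨ cong (λ y → d i * - (binom n i * y)) (^-distribʳ-* a t i) ⟩
      d i * - (binom n i * (a ^ i * t ^ i))
        ≡⟨ collect (binom n i) (a ^ (n ∸ i)) (a ^ i) (t ^ i) ⟩
      - (a ^ (n ∸ i) * a ^ i * (binom n i * binom n i * t ^ i))
        ≡⟨ cong (λ y → - (y * (binom n i * binom n i * t ^ i)))
             (trans (sym (ℤ.^-distribˡ-+-* a (n ∸ i) i)) (cong (a ^_) (ℕ.m∸n+n≡m i≤n))) ⟩
      - (a ^ n * (binom n i * binom n i * t ^ i)) ∎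

  shifted-cubicSum : ∀ (f : ℤ → ℤ) → (∀ {x y} → x ≋ y → f x ≋ f y) → ∀ c a t →
    (∀ x → f (x + c) ≡ x * (x + a) * (x + a * t)) → (∑[ x < p ] f (+ x) ^ n) ≋ - (a ^ n * squareSum t)
  shifted-cubicSum f f-cong c a t factors = begin
    (∑[ x < p ] f (+ x) ^ n)                           ≈⟨ ∑-shift (λ y → f y ^ n) (λ x≋y → ^-cong n (f-cong x≋y)) c ⟨
    (∑[ x < p ] f (+ x + c) ^ n)                       ≡⟨ ∑-cong p (λ x _ → cong (_^ n) (factors (+ x))) ⟩
    (∑[ x < p ] (+ x * (+ x + a) * (+ x + a * t)) ^ n) ≈⟨ cubicSum a t ⟩
    - (a ^ n * squareSum t)                            ∎

  legendreSum-cubic : ∀ (f : ℤ → ℤ) → (∀ {x y} → x ≋ y → f x ≋ f y) → ∀ c a t →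
    (∀ x → f (x + c) ≡ x * (x + a) * (x + a * t)) → legendreSum p f ≋ - (a ^ n * squareSum t)
  legendreSum-cubic f f-cong c a t factors = begin
    legendreSum p f                    ≡⟨ ∑-sumℤ p (λ x → legendre (f (+ x)) p) ⟩
    (∑[ x < p ] legendre (f (+ x)) p)  ≈⟨ ∑-cong-≋ p (λ x _ → euler-criterion (f (+ x))) ⟩
    (∑[ x < p ] f (+ x) ^ n)           ≈⟨ shifted-cubicSum f f-cong c a t factors ⟩
    - (a ^ n * squareSum t)            ∎

  -- The terms of 2ⁿ Pₙ(x); those with 2k > n, where the exponent is truncated, vanish.
  legendreNumerator : ℤ → ℕ → ℤ
  legendreNumerator x k = binom n k * -1ℤ ^ k * (binom (2 ℕ.* (n ∸ k)) n * x ^ (2 ℕ.* (n ∸ k) ∸ n))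

  ∑-legendreNumerator : ∀ x → (∑[ y < p ] (+ y * ((+ y + x) * (+ y + x) - 1ℤ)) ^ n) ≋ - (∑[ k < suc n ] legendreNumerator x k)
  ∑-legendreNumerator x = begin
    (∑[ y < p ] (+ y * ((+ y + x) * (+ y + x) - 1ℤ)) ^ n)
      ≡⟨ ∑-cong p (λ y _ → expand (+ y)) ⟩
    (∑[ y < p ] ∑[ k < suc n ] d k * ((+ y) ^ n * (+ y + x) ^ (2 ℕ.* (n ∸ k))))
      ≡⟨ ∑-swap p (suc n) (λ y k → d k * ((+ y) ^ n * (+ y + x) ^ (2 ℕ.* (n ∸ k)))) ⟩
    (∑[ k < suc n ] ∑[ y < p ] d k * ((+ y) ^ n * (+ y + x) ^ (2 ℕ.* (n ∸ k))))
      ≡⟨ ∑-cong (suc n) (λ k _ → ∑-*ˡ p (d k) (λ y → (+ y) ^ n * (+ y + x) ^ (2 ℕ.* (n ∸ k)))) ⟨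
    (∑[ k < suc n ] d k * (∑[ y < p ] (+ y) ^ n * (+ y + x) ^ (2 ℕ.* (n ∸ k))))
      ≈⟨ ∑-cong-≋ (suc n) inner ⟩
    (∑[ k < suc n ] - legendreNumerator x k)
      ≡⟨ ∑-neg (suc n) (legendreNumerator x) ⟩
    - (∑[ k < suc n ] legendreNumerator x k) ∎
    where
    d : ℕ → ℤ
    d k = binom n k * -1ℤ ^ k
    square : ∀ y → y * y - 1ℤ ≡ -1ℤ + y * (y * 1ℤ)
    square = solve-∀
    rearrange : ∀ a b c e → a * (b * (c * e)) ≡ b * c * (a * e)
    rearrange = solve-∀
    expand : ∀ y → (y * ((y + x) * (y + x) - 1ℤ)) ^ n ≡ ∑[ k < suc n ] d k * (y ^ n * (y + x) ^ (2 ℕ.* (n ∸ k)))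
    expand y = trans (^-distribʳ-* y ((y + x) * (y + x) - 1ℤ) n)
      (trans (cong (y ^ n *_) (trans (cong (_^ n) (square (y + x))) (binomial-theorem n -1ℤ ((y + x) ^ 2))))
      (trans (∑-*ˡ (suc n) (y ^ n) (λ k → binom n k * (-1ℤ ^ k * ((y + x) ^ 2) ^ (n ∸ k))))
        (∑-cong (suc n) λ k _ → trans (rearrange (y ^ n) (binom n k) (-1ℤ ^ k) (((y + x) ^ 2) ^ (n ∸ k)))
          (cong (λ z → d k * (y ^ n * z)) (ℤ.^-*-assoc (y + x) 2 (n ∸ k))))))
    inner : ∀ k → k ℕ.< suc n → d k * (∑[ y < p ] (+ y) ^ n * (+ y + x) ^ (2 ℕ.* (n ∸ k))) ≋ - legendreNumerator x k
    inner k _ = begin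
      d k * (∑[ y < p ] (+ y) ^ n * (+ y + x) ^ (2 ℕ.* (n ∸ k)))
        ≈⟨ *-congˡ (d k) (∑-power-shifted-power n n (2 ℕ.* (n ∸ k)) x refl
             (ℕ.≤-<-trans (ℕ.+-monoʳ-≤ n 2[n-k]≤2n) 3n<4n)) ⟩
      d k * - (binom (2 ℕ.* (n ∸ k)) n * x ^ (2 ℕ.* (n ∸ k) ∸ n))
        ≡⟨ ℤ.neg-distribʳ-* (d k) _ ⟨
      - legendreNumerator x k ∎
      where
      2[n-k]≤2n : 2 ℕ.* (n ∸ k) ℕ.≤ n ℕ.+ n
      2[n-k]≤2n = ℕ.+-mono-≤ (ℕ.m∸n≤m n k) (subst (ℕ._≤ n) (sym (ℕ.+-identityʳ (n ∸ k))) (ℕ.m∸n≤m n k))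

  -- The factor 2ⁿ is aⁿ for the root difference a = 2; it will cancel the 2⁻ⁿ in the definition of
  -- Pₙ.
  legendre-polynomial : ∀ t → (∑[ k < suc n ] legendreNumerator (1ℤ - + 2 * t) k) ≋ (+ 2) ^ n * squareSum t
  legendre-polynomial t = begin
    ∑< (suc n) (legendreNumerator x)     ≡⟨ ℤ.neg-involutive _ ⟨
    - - ∑< (suc n) (legendreNumerator x) ≈⟨ -‿cong (∑-legendreNumerator x) ⟨
    - (∑[ y < p ] f (+ y) ^ n)           ≈⟨ -‿cong (shifted-cubicSum f f-cong (+ 2 * t) (+ 2) t (factors t)) ⟩
    - - ((+ 2) ^ n * squareSum t)        ≡⟨ ℤ.neg-involutive _ ⟩
    (+ 2) ^ n * squareSum t              ∎
    where
    x = 1ℤ - + 2 * t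
    f : ℤ → ℤ
    f y = y * ((y + x) * (y + x) - 1ℤ)
    f-cong : ∀ {y z} → y ≋ z → f y ≋ f z
    f-cong y≋z = *-cong y≋z (+-cong (*-cong (+-cong y≋z (≋-refl {x})) (+-cong y≋z (≋-refl {x}))) (≋-refl { -1ℤ}))
    factors : ∀ t v → (v + + 2 * t) * ((v + + 2 * t + (1ℤ - + 2 * t)) * (v + + 2 * t + (1ℤ - + 2 * t)) - 1ℤ)
                      ≡ v * (v + + 2) * (v + + 2 * t)
    factors = solve-∀

  -- Reduction of p-integral rational numbers

  -- q ∼ z: the rational number q is p-integral and reduces to the class of z.
  infix 4 _∼_

  record _∼_ (q : ℚ) (z : ℤ) : Set where
    constructor reduces
    field
      numerator denominator : ℤ
      denominator≉0         : ¬ denominator ≋ 0ℤ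
      fraction              : q ℚ.* ι denominator ≡ ι numerator
      reduction             : numerator ≋ z * denominator

  ∼-resp : ∀ {q y z} → q ∼ y → y ≋ z → q ∼ z
  ∼-resp (reduces m d d≉0 eq m≋yd) y≋z = reduces m d d≉0 eq (≋-trans m≋yd (*-congʳ d y≋z))

  ι∼ : ∀ {a z} → a ≋ z → ι a ∼ z
  ι∼ {a} {z} a≋z = reduces a 1ℤ 1≉0 (ℚ.*-identityʳ (ι a)) (≋-trans a≋z (≋-reflexive (sym (ℤ.*-identityʳ z))))

  ∼-* : ∀ {q r y z} → q ∼ y → r ∼ z → q ℚ.* r ∼ y * z
  ∼-* {q} {r} {y} {z} (reduces m d d≉0 qd≡m m≋yd) (reduces k e e≉0 re≡k k≋ze) =
    reduces (m * k) (d * e) (*≉0 d≉0 e≉0) (fraction-* q r d e m k qd≡m re≡k)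
      (≋-trans (*-cong m≋yd k≋ze) (≋-reflexive (interchange y d z e)))
    where
    interchange : ∀ a b c d → a * b * (c * d) ≡ a * c * (b * d)
    interchange = solve-∀

  ∼-+ : ∀ {q r y z} → q ∼ y → r ∼ z → q ℚ.+ r ∼ y + z
  ∼-+ {q} {r} {y} {z} (reduces m d d≉0 qd≡m m≋yd) (reduces k e e≉0 re≡k k≋ze) =
    reduces (m * e + k * d) (d * e) (*≉0 d≉0 e≉0) (fraction-+ q r d e m k qd≡m re≡k)
      (≋-trans (+-cong (*-congʳ e m≋yd) (*-congʳ d k≋ze)) (≋-reflexive (distribute y d z e)))
    where
    distribute : ∀ y d z e → y * d * e + z * e * d ≡ (y + z) * (d * e)
    distribute = solve-∀

  ∼-neg : ∀ {q y} → q ∼ y → ℚ.- q ∼ - y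
  ∼-neg {q} {y} (reduces m d d≉0 qd≡m m≋yd) = reduces (- m) d d≉0
    (trans (sym (ℚ.neg-distribˡ-* q (ι d))) (trans (cong (λ r → ℚ.- r) qd≡m) (sym (ι-neg m))))
    (≋-trans (-‿cong m≋yd) (≋-reflexive (ℤ.neg-distribˡ-* y d)))

  ∼-^ : ∀ {q y} k → q ∼ y → q ^ℚ k ∼ y ^ k
  ∼-^ zero    q∼y = ι∼ {1ℤ} ≋-refl
  ∼-^ (suc k) q∼y = ∼-* q∼y (∼-^ k q∼y)

  ∼-sum : ∀ m {f : ℕ → ℚ} {g : ℕ → ℤ} → (∀ k → k ℕ.< m → f k ∼ g k) → sumℚ {m} (λ i → f (toℕ i)) ∼ ∑< m g
  ∼-sum zero    f∼g = ι∼ {0ℤ} (≋-reflexive (sym (∑-empty _)))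
  ∼-sum (suc m) {f} {g} f∼g = subst (sumℚ {suc m} (λ i → f (toℕ i)) ∼_) (sym (∑-first m g))
    (∼-+ (f∼g 0 (s≤s z≤n)) (∼-sum m {f ∘ suc} λ k k<m → f∼g (suc k) (s≤s k<m)))

  ∼-∑ : ∀ m {f : ℕ → ℚ} {g : ℕ → ℤ} → (∀ k → k ℕ.≤ m → f k ∼ g k) → ∑≤ m f ∼ ∑< (suc m) g
  ∼-∑ m {f} f∼g = ∼-sum (suc m) {f} λ { k (s≤s k≤m) → f∼g k k≤m }

  /∼ : ∀ a d .{{_ : ℕ.NonZero d}} {z} → ¬ + d ≋ 0ℤ → a ≋ z * + d → a ℚ./ d ∼ z
  /∼ a d d≉0 a≋zd = reduces a (+ d) d≉0 (/-cancel a d) a≋zd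

  /^∼ : ∀ a m k .{{_ : ℤ.NonZero m}} {z} → ¬ m ≋ 0ℤ → a ≋ z * m ^ k → a /[ m ^ k ] ∼ z
  /^∼ a m k m≉0 a≋zmᵏ = reduces a (m ^ k) (^≉0 k m≉0)
    (÷-cancel (ι a) (ι (m ^ k)) {{ι-nonZero (m ^ k) {{^-nonZero m k}}}}) a≋zmᵏ

  coprime-to-p : ∀ {a} → ¬ p ℕ.∣ a → Coprime a p
  coprime-to-p p∤a {d} (d∣a , d∣p) with prime⇒irreducible p-prime d∣p
  ... | inj₁ d≡1 = d≡1
  ... | inj₂ d≡p = contradiction (subst (ℕ._∣ _) d≡p d∣a) p∤a

  p≢1 : p ≢ 1
  p≢1 p≡1 = contradiction (ℕ.suc-injective p≡1) (ℕ.>⇒≢ 0<2n)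

  -- In ↥q · d = m · ↧q the factor d is a unit, so a denominator divisible by p would force p into
  -- the numerator too, against lowest terms.
  ∼⇒denominator : ∀ {q z} → q ∼ z → ¬ p ℕ.∣ ↧ₙ q
  ∼⇒denominator {q@(mkℚ _ d-1 c)} (reduces m d d≉0 eq _) p∣↧q =
    -- The coprimality stored in a rational number is irrelevant, so it is recomputed before it is
    -- used.
    p≢1 (Coprimality.recompute c (∣⇒∣ᵤ (≋0⇒∣ ↥q≋0) , p∣↧q))
    where
    ↥q≋0 : ↥ q ≋ 0ℤ
    ↥q≋0 = *≋0-cancelˡ {d} d≉0 (begin
      d * ↥ q       ≡⟨ ℤ.*-comm d (↥ q) ⟩
      ↥ q * d       ≡⟨ cross-multiply q d m eq ⟩
      m * ↧ q       ≈⟨ *-congˡ m (∣⇒≋0 (∣ᵤ⇒∣ p∣↧q)) ⟩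
      m * 0ℤ        ≡⟨ ℤ.*-zeroʳ m ⟩
      0ℤ            ∎)

  ∼⇒numerator≋0 : ∀ {q z} → q ∼ z → z ≋ 0ℤ → ↥ q ≋ 0ℤ
  ∼⇒numerator≋0 {q} {z} (reduces m d d≉0 eq m≋zd) z≋0 = *≋0-cancelˡ {d} d≉0 (begin
    d * ↥ q       ≡⟨ ℤ.*-comm d (↥ q) ⟩
    ↥ q * d       ≡⟨ cross-multiply q d m eq ⟩
    m * ↧ q       ≈⟨ *-congʳ (↧ q) (≋-trans m≋zd (*-congʳ d z≋0)) ⟩
    0ℤ * d * ↧ q  ≡⟨ cong (_* ↧ q) (ℤ.*-zeroˡ d) ⟩
    0ℤ * ↧ q      ≡⟨ ℤ.*-zeroˡ (↧ q) ⟩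
    0ℤ            ∎)

  ∼⇒≡mod : ∀ {q r z} → q ∼ z → r ∼ z → q ≡ r [mod p ]
  ∼⇒≡mod {z = z} q∼z r∼z = congruent (coprime-to-p (∼⇒denominator q∼z)) (coprime-to-p (∼⇒denominator r∼z))
    (≋0⇒∣ (∼⇒numerator≋0 (∼-+ q∼z (∼-neg r∼z)) (≋-reflexive (ℤ.+-inverseʳ z))))

  -- q is the prime of the theorem, which is p = 1 + 2n only propositionally.
  row : ∀ {a b c d z q} → q ≡ p → a ∼ z → b ∼ z → c ∼ z → d ∼ z → a ≡ b ≡ c ≡ d [mod q ]
  row refl a∼z b∼z c∼z d∼z = ∼⇒≡mod a∼z b∼z , ∼⇒≡mod b∼z c∼z , ∼⇒≡mod c∼z d∼z

  -- Central binomial coefficients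

  -- Passing from k to k + 1 multiplies the two sides by 2(2k + 1)/(k + 1) and -4(n - k)/(k + 1).
  -- The numerators differ by 2(2n + 1) = 2p, and k + 1 ≤ n can be cancelled.
  central-binom : ∀ k → k ℕ.≤ n → binom (2 ℕ.* k) k ≋ (- + 4) ^ k * binom n k
  central-binom zero    _   = ≋-reflexive (trans (binom-n-0 0) (sym (trans (ℤ.*-identityˡ _) (binom-n-0 n))))
  central-binom (suc k) k<n = *-cancelˡ (+ suc k) (small≉0 k (s≤s (ℕ.≤-trans k<n (ℕ.m≤m+n n n)))) (begin
    + suc k * binom (2 ℕ.* suc k) (suc k)
      ≡⟨ central-binom-step k ⟩
    + 2 * ((+ k + + suc k) * binom (2 ℕ.* k) k)
      ≈⟨ *-congˡ (+ 2) (*-congˡ (+ k + + suc k) (central-binom k (ℕ.<⇒≤ k<n))) ⟩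
    + 2 * ((+ k + + suc k) * (u * b))
      ≡⟨ lemma₁ (+ n) (+ k) u b ⟩
    + p * (+ 2 * (u * b)) + - + 4 * u * ((+ n - + k) * b)
      ≈⟨ +-cong (*-congʳ (+ 2 * (u * b)) p≋0) (≋-refl { - + 4 * u * ((+ n - + k) * b)}) ⟩
    0ℤ * (+ 2 * (u * b)) + - + 4 * u * ((+ n - + k) * b)
      ≡⟨ cong (λ c → 0ℤ * (+ 2 * (u * b)) + - + 4 * u * c) (binom-ratio n k) ⟨
    0ℤ * (+ 2 * (u * b)) + - + 4 * u * (+ suc k * binom n (suc k))
      ≡⟨ lemma₂ (+ 2 * (u * b)) (- + 4 * u) (+ suc k) (binom n (suc k)) ⟩
    + suc k * ((- + 4) ^ suc k * binom n (suc k)) ∎)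
    where
    u = (- + 4) ^ k
    b = binom n k
    lemma₁ : ∀ n k u b → + 2 * ((k + (1ℤ + k)) * (u * b)) ≡ (1ℤ + (n + n)) * (+ 2 * (u * b)) + - + 4 * u * ((n - k) * b)
    lemma₁ = solve-∀
    lemma₂ : ∀ a u s c → 0ℤ * a + u * (s * c) ≡ s * (u * c)
    lemma₂ = solve-∀

  C²≋ : ∀ k → k ℕ.≤ n → C² k ≋ (+ 16) ^ k * (binom n k * binom n k)
  C²≋ k k≤n = begin
    C² k                                   ≡⟨ cong (_^ 2) (binom-C (2 ℕ.* k) k) ⟩
    binom (2 ℕ.* k) k ^ 2                  ≈⟨ ^-cong 2 (central-binom k k≤n) ⟩
    ((- + 4) ^ k * binom n k) ^ 2          ≡⟨ lemma ((- + 4) ^ k) (binom n k) ⟩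
    (- + 4) ^ k * (- + 4) ^ k * (binom n k * binom n k)
      ≡⟨ cong (_* (binom n k * binom n k)) (^-distribʳ-* (- + 4) (- + 4) k) ⟨
    (+ 16) ^ k * (binom n k * binom n k)   ∎
    where
    lemma : ∀ u b → u * b * (u * b * 1ℤ) ≡ u * u * (b * b)
    lemma = solve-∀

  ∑C²/∼ : ∀ m t .{{_ : ℤ.NonZero m}} → ¬ m ≋ 0ℤ → t * m ≡ + 16 → ∑≤ n (λ k → C² k /[ m ^ k ]) ∼ squareSum t
  ∑C²/∼ m t m≉0 tm≡16 = ∼-∑ n λ k k≤n → /^∼ (C² k) m k m≉0 (begin
    C² k                                          ≈⟨ C²≋ k k≤n ⟩
    (+ 16) ^ k * (binom n k * binom n k)          ≡⟨ cong (λ a → a ^ k * (binom n k * binom n k)) tm≡16 ⟨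
    (t * m) ^ k * (binom n k * binom n k)         ≡⟨ cong (_* (binom n k * binom n k)) (^-distribʳ-* t m k) ⟩
    t ^ k * m ^ k * (binom n k * binom n k)       ≡⟨ lemma (t ^ k) (m ^ k) (binom n k * binom n k) ⟩
    binom n k * binom n k * t ^ k * m ^ k         ∎)
    where
    lemma : ∀ a b c → a * b * c ≡ c * a * b
    lemma = solve-∀

  -- Modulo p the sum is ∑ₖ C(n,k)² t⁻ᵏ, which k ↦ n - k turns into t⁻ⁿ K(t) ≡ tⁿ K(t).
  ∑C²/∼-reversed : ∀ m t .{{_ : ℤ.NonZero m}} → ¬ m ≋ 0ℤ → ¬ t ≋ 0ℤ → m ≡ + 16 * t →
                   ∑≤ n (λ k → C² k /[ m ^ k ]) ∼ t ^ n * squareSum t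
  ∑C²/∼-reversed m t m≉0 t≉0 m≡16t = subst (∑≤ n (λ k → C² k /[ m ^ k ]) ∼_) (sym reverse)
    (∼-∑ n λ k k≤n → /^∼ (C² k) m k m≉0 (≋-sym (term k k≤n)))
    where
    s : ℕ → ℤ
    s k = binom n k * binom n k * t ^ k
    reverse : t ^ n * squareSum t ≡ ∑[ k < suc n ] t ^ n * s (n ∸ k)
    reverse = trans (cong (t ^ n *_) (∑-reverse n s)) (∑-*ˡ (suc n) (t ^ n) (λ k → s (n ∸ k)))
    lemma : ∀ a b c d e → a * (b * c) * (d * e) ≡ a * (c * e) * (d * b)
    lemma = solve-∀
    term : ∀ k → k ℕ.≤ n → t ^ n * s (n ∸ k) * m ^ k ≋ C² k
    term k k≤n = begin
      t ^ n * (binom n (n ∸ k) * binom n (n ∸ k) * t ^ (n ∸ k)) * m ^ k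
        ≡⟨ cong₂ (λ c a → t ^ n * (c * c * t ^ (n ∸ k)) * a) (binom-sym k≤n)
             (trans (cong (_^ k) m≡16t) (^-distribʳ-* (+ 16) t k)) ⟩
      t ^ n * (b² * t ^ (n ∸ k)) * ((+ 16) ^ k * t ^ k)
        ≡⟨ lemma (t ^ n) b² (t ^ (n ∸ k)) ((+ 16) ^ k) (t ^ k) ⟩
      t ^ n * (t ^ (n ∸ k) * t ^ k) * ((+ 16) ^ k * b²)
        ≡⟨ cong (λ a → t ^ n * a * ((+ 16) ^ k * b²))
             (trans (sym (ℤ.^-distribˡ-+-* t (n ∸ k) k)) (cong (t ^_) (ℕ.m∸n+n≡m k≤n))) ⟩
      t ^ n * t ^ n * ((+ 16) ^ k * b²)
        ≈⟨ *-cong (≋-trans (≋-reflexive (sym (ℤ.^-distribˡ-+-* t n n))) (fermat-unit t≉0)) (≋-sym (C²≋ k k≤n)) ⟩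
      1ℤ * C² k
        ≡⟨ ℤ.*-identityˡ (C² k) ⟩
      C² k ∎
      where b² = binom n k * binom n k

  -- Coefficients of the Legendre polynomial modulo p

  2*[n∸k] : ∀ k → 2 ℕ.* (n ∸ k) ≡ 2 ℕ.* n ∸ 2 ℕ.* k
  2*[n∸k] k = ℕ.*-distribˡ-∸ 2 n k

  2*[n∸k]∸n : ∀ k → 2 ℕ.* (n ∸ k) ∸ n ≡ n ∸ 2 ℕ.* k
  2*[n∸k]∸n k = trans (cong (_∸ n) (2*[n∸k] k)) (trans (ℕ.∸-+-assoc (2 ℕ.* n) (2 ℕ.* k) n)
    (trans (cong (2 ℕ.* n ∸_) (ℕ.+-comm (2 ℕ.* k) n)) (trans (sym (ℕ.∸-+-assoc (2 ℕ.* n) n (2 ℕ.* k)))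
    (cong (_∸ 2 ℕ.* k) (trans (ℕ.m+n∸m≡n n (n ℕ.+ 0)) (ℕ.+-identityʳ n))))))

  k≤⌊n/2⌋⇒2k≤n : ∀ k → k ℕ.≤ ⌊ n /2⌋ → 2 ℕ.* k ℕ.≤ n
  k≤⌊n/2⌋⇒2k≤n k k≤ = subst (2 ℕ.* k ℕ.≤_) (ℕ.⌊n/2⌋+⌈n/2⌉≡n n)
    (ℕ.+-mono-≤ k≤ (subst (ℕ._≤ ⌈ n /2⌉) (sym (ℕ.+-identityʳ k)) (ℕ.≤-trans k≤ (ℕ.⌊n/2⌋≤⌈n/2⌉ n))))

  ⌊n/2⌋<k⇒n<2k : ∀ k → ⌊ n /2⌋ ℕ.< k → n ℕ.< 2 ℕ.* k
  ⌊n/2⌋<k⇒n<2k k k> = subst (ℕ._< 2 ℕ.* k) (ℕ.⌊n/2⌋+⌈n/2⌉≡n n)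
    -- Here ⌈n/2⌉ = ⌊(n + 1)/2⌋ is at most ⌊(n + 2)/2⌋ = ⌊n/2⌋ + 1, hence at most k.
    (ℕ.+-mono-<-≤ k> (subst (⌈ n /2⌉ ℕ.≤_) (sym (ℕ.+-identityʳ k)) (ℕ.≤-trans (ℕ.⌊n/2⌋-mono (ℕ.n≤1+n (suc n))) k>)))

  legendreNumerator-vanishing : ∀ x k → ⌊ n /2⌋ ℕ.< k → legendreNumerator x k ≡ 0ℤ
  legendreNumerator-vanishing x k k> = trans (cong (λ b → binom n k * -1ℤ ^ k * (b * x ^ (2 ℕ.* (n ∸ k) ∸ n))) (binom-zero 2[n-k]<n))
    (ℤ.*-zeroʳ (binom n k * -1ℤ ^ k))
    where
    2[n-k]<n : 2 ℕ.* (n ∸ k) ℕ.< n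
    2[n-k]<n = ℕ.≤-<-trans (ℕ.≤-reflexive (2*[n∸k] k)) (ℕ.≤-<-trans (ℕ.∸-monoʳ-≤ (2 ℕ.* n) (⌊n/2⌋<k⇒n<2k k k>))
      (subst (λ m → m ∸ suc n ℕ.< n) (cong (n ℕ.+_) (sym (ℕ.+-identityʳ n)))
        (ℕ.<-≤-trans (ℕ.∸-monoʳ-< (ℕ.n<1+n n) (ℕ.m<m+n n 0<n)) (ℕ.≤-reflexive (ℕ.m+n∸n≡m n n)))))

  ∑-legendreNumerator-truncate : ∀ x → (∑[ k < suc ⌊ n /2⌋ ] legendreNumerator x k) ≡ ∑[ k < suc n ] legendreNumerator x k
  ∑-legendreNumerator-truncate x = trans (sym (∑-truncate (suc ⌊ n /2⌋) (n ∸ ⌊ n /2⌋) (legendreNumerator x) (legendreNumerator-vanishing x)))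
    (cong (λ l → ∑< (suc l) (legendreNumerator x)) (ℕ.m+[n∸m]≡n (ℕ.⌊n/2⌋≤n n)))

  !≉0 : ∀ k → k ℕ.< p → ¬ + (k !) ≋ 0ℤ
  !≉0 zero    _    = 1≉0
  !≉0 (suc k) 1+k<p = subst (λ a → ¬ a ≋ 0ℤ) (sym (ℤ.pos-* (suc k) (k !))) (*≉0 (small≉0 k 1+k<p) (!≉0 k (ℕ.<-trans (ℕ.n<1+n k) 1+k<p)))

  coefficient-denominator : ℕ → ℕ
  coefficient-denominator k = k ! ℕ.* (n ∸ k) ! ℕ.* (n ∸ 2 ℕ.* k) !

  coefficient-denominator≢0 : ∀ k → ℕ.NonZero (coefficient-denominator k)
  coefficient-denominator≢0 k = ℕ.m*n≢0 _ _ {{ℕ.m*n≢0 _ _ {{k ℕ.!≢0}} {{(n ∸ k) ℕ.!≢0}}}} {{(n ∸ 2 ℕ.* k) ℕ.!≢0}}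

  -- A copy of the `coeff` local to `P`, with which it agrees by definition, so that lemmas can
  -- refer to it.
  coefficient : ℕ → ℚ
  coefficient k = ((-1ℤ ^ k * + ((2 ℕ.* n ∸ 2 ℕ.* k) !)) ℚ./ coefficient-denominator k) {{coefficient-denominator≢0 k}}

  -- Multiplying and dividing (2n - 2k)!/(k!(n - k)!(n - 2k)!) by n! splits it into C(n,k) C(2n -
  -- 2k,n). The denominator is a unit modulo p because its factorials are of numbers at most n.
  coefficient∼ : ∀ k → 2 ℕ.* k ℕ.≤ n → coefficient k ∼ binom n k * -1ℤ ^ k * binom (2 ℕ.* (n ∸ k)) n
  coefficient∼ k 2k≤n = /∼ (-1ℤ ^ k * + ((2 ℕ.* n ∸ 2 ℕ.* k) !)) (coefficient-denominator k)
    {{coefficient-denominator≢0 k}} denominator≉0 numerator≋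
    where
    N = 2 ℕ.* (n ∸ k)

    k≤n : k ℕ.≤ n
    k≤n = ℕ.≤-trans (ℕ.m≤m+n k _) 2k≤n

    n≤N : n ℕ.≤ N
    n≤N = subst (n ℕ.≤_) (sym (2*[n∸k] k))
      (subst (ℕ._≤ 2 ℕ.* n ∸ 2 ℕ.* k) (trans (ℕ.m+n∸m≡n n (n ℕ.+ 0)) (ℕ.+-identityʳ n)) (ℕ.∸-monoʳ-≤ (2 ℕ.* n) 2k≤n))

    denominator-factors : + coefficient-denominator k ≡ + (k ! ℕ.* (n ∸ k) !) * + ((n ∸ 2 ℕ.* k) !)
    denominator-factors = ℤ.pos-* (k ! ℕ.* (n ∸ k) !) ((n ∸ 2 ℕ.* k) !)

    numerator≋ : -1ℤ ^ k * + ((2 ℕ.* n ∸ 2 ℕ.* k) !) ≋ binom n k * -1ℤ ^ k * binom N n * + coefficient-denominator k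
    numerator≋ = begin
      -1ℤ ^ k * + ((2 ℕ.* n ∸ 2 ℕ.* k) !)
        ≡⟨ cong (λ M → -1ℤ ^ k * + (M !)) (2*[n∸k] k) ⟨
      -1ℤ ^ k * + (N !)
        ≡⟨ cong (-1ℤ ^ k *_) (binom-factorial n≤N) ⟨
      -1ℤ ^ k * (binom N n * + (n ! ℕ.* (N ∸ n) !))
        ≡⟨ cong (λ a → -1ℤ ^ k * (binom N n * a)) (ℤ.pos-* (n !) ((N ∸ n) !)) ⟩
      -1ℤ ^ k * (binom N n * (+ (n !) * + ((N ∸ n) !)))
        ≡⟨ cong₂ (λ a M → -1ℤ ^ k * (binom N n * (a * + (M !)))) (sym (binom-factorial k≤n)) (2*[n∸k]∸n k) ⟩
      -1ℤ ^ k * (binom N n * (binom n k * + (k ! ℕ.* (n ∸ k) !) * + ((n ∸ 2 ℕ.* k) !)))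
        ≡⟨ lemma (-1ℤ ^ k) (binom N n) (binom n k) (+ (k ! ℕ.* (n ∸ k) !)) (+ ((n ∸ 2 ℕ.* k) !)) ⟩
      binom n k * -1ℤ ^ k * binom N n * (+ (k ! ℕ.* (n ∸ k) !) * + ((n ∸ 2 ℕ.* k) !))
        ≡⟨ cong (binom n k * -1ℤ ^ k * binom N n *_) denominator-factors ⟨
      binom n k * -1ℤ ^ k * binom N n * + coefficient-denominator k ∎
      where
      lemma : ∀ s b c d e → s * (b * (c * d * e)) ≡ c * s * b * (d * e)
      lemma = solve-∀

    denominator≉0 : ¬ + coefficient-denominator k ≋ 0ℤ
    denominator≉0 = subst (λ a → ¬ a ≋ 0ℤ)
      (sym (trans denominator-factors (cong (_* + ((n ∸ 2 ℕ.* k) !)) (ℤ.pos-* (k !) ((n ∸ k) !)))))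
      (*≉0 (*≉0 (!≉0 k (below k≤n)) (!≉0 (n ∸ k) (below (ℕ.m∸n≤m n k))))
        (!≉0 (n ∸ 2 ℕ.* k) (below (ℕ.m∸n≤m n (2 ℕ.* k)))))
      where
      below : ∀ {j} → j ℕ.≤ n → j ℕ.< p
      below j≤n = s≤s (ℕ.≤-trans j≤n (ℕ.m≤m+n n n))

  -- 2(n + 1) = p + 1.
  ½∼ : ½ ∼ + suc n
  ½∼ = reduces 1ℤ (+ 2) 2≉0 refl (difference≋0⇒≋ (begin
    1ℤ - + suc n * + 2   ≡⟨ lemma (+ n) ⟩
    - + p                ≈⟨ -‿cong p≋0 ⟩
    0ℤ                   ∎))
    where
    lemma : ∀ n → 1ℤ - (1ℤ + n) * + 2 ≡ - (1ℤ + (n + n))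
    lemma = solve-∀

  [1+n]*2≋1 : + suc n * + 2 ≋ 1ℤ
  [1+n]*2≋1 = ≋-sym (_∼_.reduction ½∼)

  P∼ : ∀ {q x} t → q ∼ x → x ≡ 1ℤ - + 2 * t → P n q ∼ squareSum t
  P∼ {q} {x} t q∼x refl = ∼-resp (∼-* (∼-^ n ½∼) (∼-∑ ⌊ n /2⌋ {λ k → coefficient k ℚ.* q ^ℚ (n ∸ 2 ℕ.* k)} {legendreNumerator x} term)) (begin
    (+ suc n) ^ n * (∑[ k < suc ⌊ n /2⌋ ] legendreNumerator x k)
      ≡⟨ cong ((+ suc n) ^ n *_) (∑-legendreNumerator-truncate x) ⟩
    (+ suc n) ^ n * (∑[ k < suc n ] legendreNumerator x k)
      ≈⟨ *-congˡ ((+ suc n) ^ n) (legendre-polynomial t) ⟩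
    (+ suc n) ^ n * ((+ 2) ^ n * squareSum t)
      ≡⟨ ℤ.*-assoc ((+ suc n) ^ n) ((+ 2) ^ n) (squareSum t) ⟨
    (+ suc n) ^ n * (+ 2) ^ n * squareSum t
      ≡⟨ cong (_* squareSum t) (^-distribʳ-* (+ suc n) (+ 2) n) ⟨
    (+ suc n * + 2) ^ n * squareSum t
      ≈⟨ *-congʳ (squareSum t) (^-cong {+ suc n * + 2} {1ℤ} n [1+n]*2≋1) ⟩
    1ℤ ^ n * squareSum t
      ≡⟨ trans (cong (_* squareSum t) (ℤ.^-zeroˡ n)) (ℤ.*-identityˡ (squareSum t)) ⟩
    squareSum t ∎)
    where
    term : ∀ k → k ℕ.≤ ⌊ n /2⌋ → coefficient k ℚ.* q ^ℚ (n ∸ 2 ℕ.* k) ∼ legendreNumerator x k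
    term k k≤ = subst (coefficient k ℚ.* q ^ℚ (n ∸ 2 ℕ.* k) ∼_)
      (trans (ℤ.*-assoc (binom n k * -1ℤ ^ k) (binom (2 ℕ.* (n ∸ k)) n) (x ^ (n ∸ 2 ℕ.* k)))
        (cong (λ j → binom n k * -1ℤ ^ k * (binom (2 ℕ.* (n ∸ k)) n * x ^ j)) (sym (2*[n∸k]∸n k))))
      (∼-* (coefficient∼ k (k≤⌊n/2⌋⇒2k≤n k k≤)) (∼-^ (n ∸ 2 ℕ.* k) q∼x))

  -- Signs and the entries of a row

  neg≉0 : ∀ {a} → ¬ a ≋ 0ℤ → ¬ - a ≋ 0ℤ
  neg≉0 {a} a≉0 -a≋0 = a≉0 (≋-trans (≋-reflexive (sym (ℤ.neg-involutive a))) (-‿cong { - a} {0ℤ} -a≋0))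

  2^≉0 : ∀ k → ¬ (+ 2) ^ k ≋ 0ℤ
  2^≉0 k = ^≉0 k 2≉0

  3<p : 3 ℕ.< p
  3<p = s≤s (ℕ.+-mono-≤ (ℕ.<⇒≤ 1<n) 1<n)

  3≉0 : ¬ + 3 ≋ 0ℤ
  3≉0 = small≉0 2 3<p

  3∤p : ¬ 3 ℕ.∣ p
  3∤p 3∣p with prime⇒irreducible p-prime 3∣p
  ... | inj₁ ()
  ... | inj₂ 3≡p = ℕ.<⇒≢ 3<p 3≡p

  ^n-unit : ∀ a → ¬ a ≋ 0ℤ → a ^ n * a ^ n ≋ 1ℤ
  ^n-unit a a≉0 = ≋-trans (≋-reflexive (sym (ℤ.^-distribˡ-+-* a n n))) (fermat-unit a≉0)

  -- (s²)ⁿ = s²ⁿ ≡ 1, so an n-th power sees only the square class. This turns the signs of the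
  -- theorem into tⁿ: -16 = -1 · 4², 8 = 2 · 2² and -4 = -1 · 2².
  square-twist : ∀ u s → ¬ s ≋ 0ℤ → u ^ n ≋ (u * (s * s)) ^ n
  square-twist u s s≉0 = begin
    u ^ n                       ≡⟨ ℤ.*-identityʳ (u ^ n) ⟨
    u ^ n * 1ℤ                  ≈⟨ *-congˡ (u ^ n) (^n-unit s s≉0) ⟨
    u ^ n * (s ^ n * s ^ n)     ≡⟨ cong (u ^ n *_) (^-distribʳ-* s s n) ⟨
    u ^ n * (s * s) ^ n         ≡⟨ ^-distribʳ-* u (s * s) n ⟨
    (u * (s * s)) ^ n           ∎

  ε∑C²/∼ : ∀ m t ε .{{_ : ℤ.NonZero m}} → ¬ m ≋ 0ℤ → ¬ t ≋ 0ℤ → m ≡ + 16 * t → ε ≋ t ^ n →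
           ι ε ℚ.* ∑≤ n (λ k → C² k /[ m ^ k ]) ∼ squareSum t
  ε∑C²/∼ m t ε m≉0 t≉0 m≡16t ε≋tⁿ = ∼-resp (∼-* (ι∼ {ε} ≋-refl) (∑C²/∼-reversed m t m≉0 t≉0 m≡16t)) (begin
    ε * (t ^ n * squareSum t)       ≈⟨ *-congʳ (t ^ n * squareSum t) ε≋tⁿ ⟩
    t ^ n * (t ^ n * squareSum t)   ≡⟨ ℤ.*-assoc (t ^ n) (t ^ n) (squareSum t) ⟨
    t ^ n * t ^ n * squareSum t     ≈⟨ *-congʳ (squareSum t) (^n-unit t t≉0) ⟩
    1ℤ * squareSum t                ≡⟨ ℤ.*-identityˡ (squareSum t) ⟩
    squareSum t                     ∎)

  ∑C²∼ : ∑≤ n (λ k → ι (C² k)) ∼ squareSum (+ 16)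
  ∑C²∼ = ∼-∑ n λ k k≤n → ι∼ (≋-trans (C²≋ k k≤n) (≋-reflexive (ℤ.*-comm ((+ 16) ^ k) (binom n k * binom n k))))

  ∑±C²∼ : ∑≤ n (λ k → ι (-1ℤ ^ k * C² k)) ∼ squareSum (- + 16)
  ∑±C²∼ = ∼-∑ n λ k k≤n → ι∼ (begin
    -1ℤ ^ k * C² k                                      ≈⟨ *-congˡ (-1ℤ ^ k) (C²≋ k k≤n) ⟩
    -1ℤ ^ k * ((+ 16) ^ k * (binom n k * binom n k))    ≡⟨ lemma (-1ℤ ^ k) ((+ 16) ^ k) (binom n k * binom n k) ⟩
    binom n k * binom n k * (-1ℤ ^ k * (+ 16) ^ k)      ≡⟨ cong (binom n k * binom n k *_) (^-distribʳ-* -1ℤ (+ 16) k) ⟨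
    binom n k * binom n k * (- + 16) ^ k                ∎)
    where
    lemma : ∀ a b c → a * (b * c) ≡ c * (a * b)
    lemma = solve-∀

  -- The character sum is ≡ -aⁿ K(t), and the prefactor v ≡ -aⁿ undoes this because a²ⁿ ≡ 1.
  legendreSum∼ : ∀ B C c a t {q v} → (∀ x → (x + c) ^ 3 - B * (x + c) + C ≡ x * (x + a) * (x + a * t)) →
    ¬ a ≋ 0ℤ → q ≡ p → v ≋ - (a ^ n) → ι (v * legendreSum q (λ x → x ^ 3 - B * x + C)) ∼ squareSum t
  legendreSum∼ B C c a t {v = v} factors a≉0 refl v≋-aⁿ = ι∼ (begin
    v * legendreSum p (λ x → x ^ 3 - B * x + C)
      ≈⟨ *-cong v≋-aⁿ (legendreSum-cubic (λ x → x ^ 3 - B * x + C) cubic-cong c a t factors) ⟩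
    - (a ^ n) * - (a ^ n * squareSum t)
      ≡⟨ lemma (a ^ n) (squareSum t) ⟩
    a ^ n * a ^ n * squareSum t
      ≈⟨ *-congʳ (squareSum t) (^n-unit a a≉0) ⟩
    1ℤ * squareSum t
      ≡⟨ ℤ.*-identityˡ (squareSum t) ⟩
    squareSum t ∎)
    where
    cubic-cong : ∀ {x y} → x ≋ y → x ^ 3 - B * x + C ≋ y ^ 3 - B * y + C
    cubic-cong x≋y = +-cong (+-cong (^-cong 3 x≋y) (-‿cong (*-congˡ B x≋y))) (≋-refl {C})
    lemma : ∀ a b → - a * - (a * b) ≡ a * a * b
    lemma = solve-∀

  -legendre[p/3]≋ : ∀ {q} → q ≡ p → - legendre (+ q) 3 ≋ - ((- + 3) ^ n)
  -legendre[p/3]≋ refl = -‿cong (legendre[p/3] 3∤p)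

  -1^[1+n]≋ : ∀ {m} → m ≡ suc n → -1ℤ ^ m ≋ - (-1ℤ ^ n)
  -1^[1+n]≋ refl = ≋-reflexive (ℤ.-1*i≡-i (-1ℤ ^ n))

  euler : ∀ a {q} → q ≡ p → legendre a q ≋ a ^ n
  euler a refl = euler-criterion a

-- From a prime above 3 to the form 2n + 1

prime>3-odd : ∀ {p} → Prime p → 3 ℕ.< p → ∃ λ m → p ≡ suc (m ℕ.* 2)
prime>3-odd {p} p-prime 3<p = cases (p % 2) (p / 2) (m%n<n p 2) (m≡m%n+[m/n]*n p 2)
  where
  2∤p : ¬ 2 ℕ.∣ p
  2∤p 2∣p with prime⇒irreducible p-prime 2∣p
  ... | inj₁ ()
  ... | inj₂ refl = contradiction 3<p λ { (s≤s (s≤s ())) }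

  cases : ∀ r m → r ℕ.< 2 → p ≡ r ℕ.+ m ℕ.* 2 → ∃ λ m → p ≡ suc (m ℕ.* 2)
  cases zero          m _              eq = contradiction (ℕ.divides m eq) 2∤p
  cases (suc zero)    m _              eq = m , eq
  cases (suc (suc _)) m (s≤s (s≤s ())) eq

odd-halves : ∀ {p} → (∃ λ m → p ≡ suc (m ℕ.* 2)) →
             p ≡ suc ((p ∸ 1) / 2 ℕ.+ (p ∸ 1) / 2) × (p ℕ.+ 1) / 2 ≡ suc ((p ∸ 1) / 2)
odd-halves (m , refl) = cong suc (trans m*2≡m+m (cong (λ k → k ℕ.+ k) (sym (m*n/n≡m m 2)))) ,
  trans (cong (λ k → suc k / 2) (ℕ.+-comm (m ℕ.* 2) 1)) (trans (m*n/n≡m (suc m) 2) (cong suc (sym (m*n/n≡m m 2))))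
  where
  m*2≡m+m : m ℕ.* 2 ≡ m ℕ.+ m
  m*2≡m+m = trans (ℕ.*-comm m 2) (cong (m ℕ.+_) (ℕ.+-identityʳ m))

theorem2p12 : (p : ℕ) → Prime p → 3 ℕ.< p →
    let n = (p ∸ 1) / 2
        n⁺ = (p ℕ.+ 1) / 2
    in
      ( P n (ι (- + 31))
      ≡ ∑[ k ≤ n ] (ι (C² k))
      ≡ ∑[ k ≤ n ] (C² k /[ + 256 ^ k ])
      ≡ ι (- legendre (+ p) 3 * legendreSum p (λ x → x ^ 3 - + 723 * x - + 7378))
        [mod p ] )
    × ( P n (ι (+ 33))
      ≡ ∑[ k ≤ n ] (ι (-1ℤ ^ k * C² k))
      ≡ ι (-1ℤ ^ n) ℚ.* (∑[ k ≤ n ] (C² k /[ - + 256 ^ k ]))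
      ≡ ι (-1ℤ ^ n⁺ * legendreSum p (λ x → x ^ 3 - + 91 * x + + 330))
        [mod p ] )
    × ( P n (ι (- + 15))
      ≡ ∑[ k ≤ n ] (C² k /[ + 2 ^ k ])
      ≡ ι (legendre (+ 2) p) ℚ.* (∑[ k ≤ n ] (C² k /[ + 128 ^ k ]))
      ≡ ι (-1ℤ ^ n⁺ * legendreSum p (λ x → x ^ 3 - + 19 * x - + 30))
        [mod p ] )
    × ( P n (ι (+ 9))
      ≡ ∑[ k ≤ n ] (C² k /[ - + 4 ^ k ])
      ≡ ι (-1ℤ ^ n) ℚ.* (∑[ k ≤ n ] (C² k /[ - + 64 ^ k ]))
      ≡ ι (-1ℤ ^ n⁺ * legendreSum p (λ x → x ^ 3 - + 7 * x + + 6))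
        [mod p ] )
    × ( P n (ι (+ 5))
      ≡ ∑[ k ≤ n ] (C² k /[ - + 8 ^ k ])
      ≡ ι (legendre (- + 2) p) ℚ.* (∑[ k ≤ n ] (C² k /[ - + 32 ^ k ]))
      ≡ ι (- legendre (+ p) 3 * legendreSum p (λ x → x ^ 3 - + 21 * x + + 20))
        [mod p ] )
theorem2p12 p p-prime 3<p =
    -- In every row t = (1 - x)/2 for the argument x of Pₙ, and the two binomial sums have bases
    -- 16/t and 16t; the bases 1 and -1 of the first two rows need no denominators. For the cubic, c
    -- is one root, and c - a and c - at are the others.
    row p≡ (P∼ (+ 16) (ι∼ { - + 31} ≋-refl) refl)
           ∑C²∼
           (∼-resp (∑C²/∼-reversed (+ 256) (+ 16) (2^≉0 8) (2^≉0 4) refl) 16ⁿK≋K)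
           (legendreSum∼ (+ 723) (- + 7378) (- + 17) (- + 3) (+ 16) factors₁ (neg≉0 3≉0) p≡ (-legendre[p/3]≋ p≡))
  , row p≡ (P∼ (- + 16) (ι∼ {+ 33} ≋-refl) refl)
           ∑±C²∼
           (ε∑C²/∼ (- + 256) (- + 16) (-1ℤ ^ n) (neg≉0 (2^≉0 8)) (neg≉0 (2^≉0 4)) refl (square-twist -1ℤ (+ 4) (2^≉0 2)))
           (legendreSum∼ (+ 91) (+ 330) (+ 5) -1ℤ (- + 16) factors₂ (neg≉0 1≉0) p≡ (-1^[1+n]≋ n⁺≡))
  , row p≡ (P∼ (+ 8) (ι∼ { - + 15} ≋-refl) refl)
           (∑C²/∼ (+ 2) (+ 8) 2≉0 refl)
           (ε∑C²/∼ (+ 128) (+ 8) (legendre (+ 2) p) (2^≉0 7) (2^≉0 3) refl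
             (≋-trans (euler (+ 2) p≡) (square-twist (+ 2) (+ 2) 2≉0)))
           (legendreSum∼ (+ 19) (- + 30) (- + 3) -1ℤ (+ 8) factors₃ (neg≉0 1≉0) p≡ (-1^[1+n]≋ n⁺≡))
  , row p≡ (P∼ (- + 4) (ι∼ {+ 9} ≋-refl) refl)
           (∑C²/∼ (- + 4) (- + 4) (neg≉0 (2^≉0 2)) refl)
           (ε∑C²/∼ (- + 64) (- + 4) (-1ℤ ^ n) (neg≉0 (2^≉0 6)) (neg≉0 (2^≉0 2)) refl (square-twist -1ℤ (+ 2) 2≉0))
           (legendreSum∼ (+ 7) (+ 6) (+ 1) -1ℤ (- + 4) factors₄ (neg≉0 1≉0) p≡ (-1^[1+n]≋ n⁺≡))
  , row p≡ (P∼ (- + 2) (ι∼ {+ 5} ≋-refl) refl)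
           (∑C²/∼ (- + 8) (- + 2) (neg≉0 (2^≉0 3)) refl)
           (ε∑C²/∼ (- + 32) (- + 2) (legendre (- + 2) p) (neg≉0 (2^≉0 5)) (neg≉0 2≉0) refl (euler (- + 2) p≡))
           (legendreSum∼ (+ 21) (+ 20) (+ 1) (- + 3) (- + 2) factors₅ (neg≉0 3≉0) p≡ (-legendre[p/3]≋ p≡))
  where
  n = (p ∸ 1) / 2

  p≡ : p ≡ suc (n ℕ.+ n)
  p≡ = proj₁ (odd-halves (prime>3-odd p-prime 3<p))

  n⁺≡ : (p ℕ.+ 1) / 2 ≡ suc n
  n⁺≡ = proj₂ (odd-halves (prime>3-odd p-prime 3<p))

  1<n : 1 ℕ.< n
  1<n = ℕ.≰⇒> λ n≤1 → ℕ.<⇒≱ 3<p (subst (ℕ._≤ 3) (sym p≡) (s≤s (ℕ.+-mono-≤ n≤1 n≤1)))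

  open OddPrime n (subst Prime p≡ p-prime) 1<n hiding (p; 3<p)

  -- The sign tⁿ is trivial here since 16 = 4², which is why the second binomial sum of the first
  -- row has no factor in front.
  16ⁿK≋K : (+ 16) ^ n * squareSum (+ 16) ≋ squareSum (+ 16)
  16ⁿK≋K = ≋-trans (*-congʳ (squareSum (+ 16)) (euler-residue (+ 4) (2^≉0 4) ≋-refl))
    (≋-reflexive (ℤ.*-identityˡ (squareSum (+ 16))))

  -- The shift is a root of the cubic such that its differences to the other two roots have ratio t.
  factors₁ : ∀ x → (x + - + 17) * ((x + - + 17) * ((x + - + 17) * 1ℤ)) - + 723 * (x + - + 17) + - + 7378
                   ≡ x * (x + - + 3) * (x + - + 48)
  factors₁ = solve-∀

  factors₂ : ∀ x → (x + + 5) * ((x + + 5) * ((x + + 5) * 1ℤ)) - + 91 * (x + + 5) + + 330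
                   ≡ x * (x + -1ℤ) * (x + + 16)
  factors₂ = solve-∀

  factors₃ : ∀ x → (x + - + 3) * ((x + - + 3) * ((x + - + 3) * 1ℤ)) - + 19 * (x + - + 3) + - + 30
                   ≡ x * (x + -1ℤ) * (x + - + 8)
  factors₃ = solve-∀

  factors₄ : ∀ x → (x + + 1) * ((x + + 1) * ((x + + 1) * 1ℤ)) - + 7 * (x + + 1) + + 6
                   ≡ x * (x + -1ℤ) * (x + + 4)
  factors₄ = solve-∀

  factors₅ : ∀ x → (x + + 1) * ((x + + 1) * ((x + + 1) * 1ℤ)) - + 21 * (x + + 1) + + 20
                   ≡ x * (x + - + 3) * (x + + 6)
  factors₅ = solve-∀
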